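{- Let $H$ be a connected rooted graph on $h\ge 1$ vertices with root $o$, let $G$ be any graph, let $\Delta\ge 0$ be a real number, and let $\boldsymbol\alpha=(\alpha_w)_{w\in V(H)}$ be a vector of non-negative real numbers indexed by the vertices of $H$. Put $|\boldsymbol\alpha|:=\sum_{w\in V(H)}\alpha_w$ and $$\hom_{\Delta,\boldsymbol\alpha}(H,G):=\sum_{\varphi\in \operatorname{Hom}(H,G)}\mathbf 1_{\{d_{\varphi(o)}\ge\Delta\}}\prod_{w\in V(H)}d_{\varphi(w)}^{\,\alpha_w},$$ where $\operatorname{Hom}(H,G)$ is the set of homomorphisms $H\to G$ and $d_v$ denotes the degree of a vertex $v$ in $G$. Then $$\hom_{\Delta,\boldsymbol\alpha}(H,G)\le\sum_{v\in V(G)} d_v^{\,h-1+|\boldsymbol\alpha|}\,\mathbf 1_{\{d_v\ge\Delta\}}.$$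
   Context: Graphs are finite and simple (undirected, without loops or multiple edges). A homomorphism $H\to G$ is a map $V(H)\to V(G)$ sending adjacent vertices to adjacent vertices. A rooted graph is a graph with a distinguished vertex, its root. $\mathbf 1_{\{\cdot\}}$ is the indicator. Convention: $0^0=1$. -}

module Defs where

open import Algebra.Bundles using (CommutativeRing)
open import Data.Fin.Base using (Fin; finToFun)
open import Data.Fin.Properties using (all?)
open import Data.Integer.Base as ℤ using (+_)
import Data.Integer.Properties as ℤ
open import Data.List.Base using (List; foldr; map; filter; length; allFin)
open import Data.Nat.Base as ℕ using (ℕ; zero; suc)
import Data.Nat.Properties as ℕ
open import Data.Product.Base using (∃; ∃₂; _×_; _,_)
open import Data.Rational.Base as ℚ using (ℚ; 0ℚ; 1ℚ; mkℚ; _/_)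
import Data.Rational.Properties as ℚ
import Data.Rational.Unnormalised.Base as ℚᵘ
import Data.Rational.Unnormalised.Properties as ℚᵘ
open import Data.Sum.Base using (_⊎_; inj₁; inj₂)
open import Level using (0ℓ)
open import Relation.Binary.Construct.Closure.ReflexiveTransitive using (Star)
open import Relation.Binary.Core using (Rel)
open import Relation.Binary.Definitions using (Decidable; Symmetric)
open import Relation.Binary.PropositionalEquality
  using (_≡_; refl; sym; subst; subst₂)
open import Relation.Nullary using (Dec; ¬_; _→-dec_)
open import Relation.Unary using (Pred; _∈_; _⊆_)
open import Algebra.Definitions.RawSemiring ℚ.+-*-rawSemiring public
  using () renaming (_^_ to _^ℚ_)
import Algebra.Properties.CommutativeSemiring.Exp
  (CommutativeRing.commutativeSemiring ℚ.+-*-commutativeRing) as Exp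

ℕ→ℚ : ℕ → ℚ
ℕ→ℚ n = + n / 1

-- A non-negative real number is represented by its left Dedekind cut
-- { q ∈ ℚ ∣ q < x }.  Non-negativity of x says that the cut contains
-- every negative rational, which also makes the cut inhabited.  Cuts are not
-- required to be located, so that 0 ^ α and the indicator of an undecided
-- proposition exist constructively; classically every cut is located.

record ℝ≥0 : Set₁ where
  field
    cut      : Pred ℚ 0ℓ
    negative : ∀ {q} → q ℚ.< 0ℚ → q ∈ cut
    bounded  : ∃ λ b → ∀ {q} → q ∈ cut → q ℚ.≤ b
    closed   : ∀ {p q} → p ℚ.< q → q ∈ cut → p ∈ cut
    open′    : ∀ {q} → q ∈ cut → ∃ λ r → q ℚ.< r × r ∈ cut

open ℝ≥0 public

infix 4 _≤_ _≼_

_≤_ : Rel ℝ≥0 0ℓ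
x ≤ y = cut x ⊆ cut y

-- A rational is at most a real (non-strict, unlike membership in the cut).

_≼_ : ℚ → ℝ≥0 → Set
r ≼ x = ∀ {q} → q ℚ.< r → q ∈ cut x

≼-bound : ∀ {r b} (x : ℝ≥0) → (∀ {q} → q ∈ cut x → q ℚ.≤ b) → r ≼ x → r ℚ.≤ b
≼-bound x x≤b r≼x = ℚ.≮⇒≥ λ b<r →
  let (q , b<q , q<r) = ℚ.<-dense b<r
  in ℚ.<-irrefl refl (ℚ.<-≤-trans b<q (x≤b (r≼x q<r)))

0≼ : ∀ x → 0ℚ ≼ x
0≼ x = negative x

-- The least upper bound of a bounded set of rationals containing 0.

sup : (S : Pred ℚ 0ℓ) → 0ℚ ∈ S → (∃ λ b → ∀ {r} → r ∈ S → r ℚ.≤ b) → ℝ≥0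
sup S 0∈S (b , S≤b) = record
  { cut      = λ q → ∃ λ r → q ℚ.< r × r ∈ S
  ; negative = λ q<0 → 0ℚ , q<0 , 0∈S
  ; bounded  = b , λ (r , q<r , r∈S) → ℚ.≤-trans (ℚ.<⇒≤ q<r) (S≤b r∈S)
  ; closed   = λ p<q (r , q<r , r∈S) → r , ℚ.<-trans p<q q<r , r∈S
  ; open′    = λ (r , q<r , r∈S) →
      let (s , q<s , s<r) = ℚ.<-dense q<r in s , q<s , r , s<r , r∈S
  }

0≤ℕ→ℚ : ∀ n → 0ℚ ℚ.≤ ℕ→ℚ n
0≤ℕ→ℚ n = ℚ.nonNegative⁻¹ (ℕ→ℚ n) ⦃ ℚ.normalize-nonNeg n 1 ⦄

fromℕ : ℕ → ℝ≥0
fromℕ n = sup (λ r → r ≡ 0ℚ ⊎ r ≡ ℕ→ℚ n) (inj₁ refl)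
  (ℕ→ℚ n , λ { (inj₁ refl) → 0≤ℕ→ℚ n ; (inj₂ refl) → ℚ.≤-refl })

-- The indicator of P: 1 if P holds and 0 if it does not.

𝟙 : Set → ℝ≥0
𝟙 P = sup (λ r → r ≡ 0ℚ ⊎ (r ≡ 1ℚ × P)) (inj₁ refl)
  (1ℚ , λ { (inj₁ refl) → 0≤ℕ→ℚ 1 ; (inj₂ (refl , _)) → ℚ.≤-refl })

infixl 6 _+_
infixl 7 _*_

_+_ : ℝ≥0 → ℝ≥0 → ℝ≥0
x + y = sup (λ r → ∃₂ λ p q → p ≼ x × q ≼ y × r ≡ p ℚ.+ q)
  (0ℚ , 0ℚ , 0≼ x , 0≼ y , refl)
  (let (a , x≤a) = bounded x ; (b , y≤b) = bounded y in
   a ℚ.+ b , λ { (p , q , p≼x , q≼y , refl) →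
     ℚ.+-mono-≤ (≼-bound x x≤a p≼x) (≼-bound y y≤b q≼y) })

*-mono : ∀ {p q a b} → 0ℚ ℚ.≤ q → 0ℚ ℚ.≤ a → p ℚ.≤ a → q ℚ.≤ b → p ℚ.* q ℚ.≤ a ℚ.* b
*-mono {p} {q} {a} {b} 0≤q 0≤a p≤a q≤b = ℚ.≤-trans
  (ℚ.*-monoʳ-≤-nonNeg q ⦃ ℚ.nonNegative 0≤q ⦄ p≤a)
  (ℚ.*-monoˡ-≤-nonNeg a ⦃ ℚ.nonNegative 0≤a ⦄ q≤b)

_*_ : ℝ≥0 → ℝ≥0 → ℝ≥0
x * y = sup
  (λ r → ∃₂ λ p q → 0ℚ ℚ.≤ p × 0ℚ ℚ.≤ q × p ≼ x × q ≼ y × r ≡ p ℚ.* q)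
  (0ℚ , 0ℚ , ℚ.≤-refl , ℚ.≤-refl , 0≼ x , 0≼ y , refl)
  (let (a , x≤a) = bounded x ; (b , y≤b) = bounded y in
   a ℚ.* b , λ { (p , q , 0≤p , 0≤q , p≼x , q≼y , refl) →
     *-mono 0≤q (≼-bound x x≤a (0≼ x)) (≼-bound x x≤a p≼x) (≼-bound y y≤b q≼y) })

-- For d ≥ 1 and rational m / n ≥ 0, d ^ (m / n) is the least upper bound of
-- the r ≥ 0 with r ^ n ≤ d ^ m; for real α ≥ 0, d ^ α is the least upper bound
-- of the d ^ (m / n) over all m / n ≤ α.  Both suprema are taken at once.

RootBelow : ℕ → ℝ≥0 → Pred ℚ 0ℓ
RootBelow d α r = 0ℚ ℚ.≤ r ×
  ∃₂ λ m n → (+ m / suc n) ≼ α × (r ^ℚ suc n) ℚ.≤ (ℕ→ℚ d ^ℚ m)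

0≤^ : ∀ {p} n → 0ℚ ℚ.≤ p → 0ℚ ℚ.≤ p ^ℚ n
0≤^ zero    0≤p = 0≤ℕ→ℚ 1
0≤^ {p} (suc n) 0≤p = subst (ℚ._≤ p ℚ.* p ^ℚ n) (ℚ.*-zeroʳ p)
  (ℚ.*-monoˡ-≤-nonNeg p ⦃ ℚ.nonNegative 0≤p ⦄ (0≤^ n 0≤p))

1≤^ : ∀ {p} n → 1ℚ ℚ.≤ p → 1ℚ ℚ.≤ p ^ℚ n
1≤^ zero    1≤p = ℚ.≤-refl
1≤^ (suc n) 1≤p =
  *-mono {1ℚ} {1ℚ} (0≤ℕ→ℚ 1) (ℚ.≤-trans (0≤ℕ→ℚ 1) 1≤p) 1≤p (1≤^ n 1≤p)

^-monoʳ : ∀ {p m n} → 1ℚ ℚ.≤ p → m ℕ.≤ n → p ^ℚ m ℚ.≤ p ^ℚ n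
^-monoʳ {n = n} 1≤p ℕ.z≤n = 1≤^ n 1≤p
^-monoʳ {p} 1≤p (ℕ.s≤s m≤n) =
  ℚ.*-monoˡ-≤-nonNeg p ⦃ ℚ.nonNegative (ℚ.≤-trans (0≤ℕ→ℚ 1) 1≤p) ⦄ (^-monoʳ 1≤p m≤n)

^-mono-< : ∀ {p q} n → 0ℚ ℚ.≤ p → p ℚ.< q → p ^ℚ suc n ℚ.< q ^ℚ suc n
^-mono-< {p} {q} zero 0≤p p<q =
  subst₂ ℚ._<_ (sym (ℚ.*-identityʳ p)) (sym (ℚ.*-identityʳ q)) p<q
^-mono-< {p} {q} (suc n) 0≤p p<q = ℚ.≤-<-trans
  (ℚ.*-monoʳ-≤-nonNeg (p ^ℚ suc n) ⦃ ℚ.nonNegative (0≤^ (suc n) 0≤p) ⦄ (ℚ.<⇒≤ p<q))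
  (ℚ.*-monoʳ-<-pos q ⦃ ℚ.positive (ℚ.≤-<-trans 0≤p p<q) ⦄ (^-mono-< n 0≤p p<q))

1≤ℕ→ℚ : ∀ d → 1ℚ ℚ.≤ ℕ→ℚ (suc d)
1≤ℕ→ℚ d = ℚ.toℚᵘ-cancel-≤ (ℚᵘ.≤-respʳ-≃ (ℚᵘ.≃-sym (ℚ.toℚᵘ-fromℚᵘ (ℚᵘ.mkℚᵘ (+ suc d) 0)))
  (ℚᵘ.*≤* (ℤ.+≤+ (ℕ.s≤s ℕ.z≤n))))

numerator-bound : ∀ {m n b} → + m / suc n ℚ.≤ b → m ℕ.≤ ℤ.∣ ℚ.↥ b ∣ ℕ.* suc n
numerator-bound {m} {n} {b@(mkℚ i k _)} m/n≤b
  with ℚᵘ.≤-respˡ-≃ (ℚ.toℚᵘ-fromℚᵘ (ℚᵘ.mkℚᵘ (+ m) n)) (ℚ.toℚᵘ-mono-≤ m/n≤b)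
... | ℚᵘ.*≤* le = ℕ.≤-trans (ℕ.m≤m*n m (suc k)) (ℤ.drop‿+≤+ (ℤ.≤-trans
    (subst (ℤ._≤ i ℤ.* + suc n) (sym (ℤ.pos-* m (suc k))) le)
    (subst (i ℤ.* + suc n ℤ.≤_) (sym (ℤ.pos-* ℤ.∣ i ∣ (suc n)))
      (ℤ.*-monoʳ-≤-nonNeg (+ suc n) (i≤∣i∣ i)))))
  where
  i≤∣i∣ : ∀ i → i ℤ.≤ + ℤ.∣ i ∣
  i≤∣i∣ (+ _)        = ℤ.≤-refl
  i≤∣i∣ (ℤ.-[1+ _ ]) = ℤ.-≤+

RootBelow-zero : ∀ d α → 0ℚ ∈ RootBelow (suc d) α
RootBelow-zero d α = ℚ.≤-refl , 0 , 0 , 0≼ α , 0≤ℕ→ℚ 1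

RootBelow-bounded : ∀ d α → ∃ λ b → ∀ {r} → r ∈ RootBelow (suc d) α → r ℚ.≤ b
RootBelow-bounded d α =
  let (b , α≤b) = bounded α
      D = ℕ→ℚ (suc d)
      N = ℤ.∣ ℚ.↥ b ∣
  in D ^ℚ N , λ { {r} (0≤r , m , n , m/n≼α , r^n≤D^m) → ℚ.≮⇒≥ λ D^N<r →
    ℚ.<-irrefl refl (ℚ.<-≤-trans (^-mono-< n (0≤^ N (0≤ℕ→ℚ (suc d))) D^N<r)
      (ℚ.≤-trans r^n≤D^m (subst (D ^ℚ m ℚ.≤_) (sym (Exp.^-assocʳ D N (suc n)))
        (^-monoʳ {m = m} (1≤ℕ→ℚ d) (numerator-bound {m} {n} (≼-bound α α≤b m/n≼α)))))) }

-- 0 ^ α is 1 if α = 0, and 0 otherwise.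

infixr 8 _^_

_^_ : ℕ → ℝ≥0 → ℝ≥0
zero  ^ α = 𝟙 (α ≤ fromℕ 0)
suc d ^ α = sup (RootBelow (suc d) α) (RootBelow-zero d α) (RootBelow-bounded d α)

∑ ∏ : ∀ {a} {A : Set a} → List A → (A → ℝ≥0) → ℝ≥0
∑ xs f = foldr (λ x s → f x + s) (fromℕ 0) xs
∏ xs f = foldr (λ x p → f x * p) (fromℕ 1) xs

record Graph (n : ℕ) : Set₁ where
  field
    Adj       : Rel (Fin n) 0ℓ
    adj?      : Decidable Adj
    symmetric : Symmetric Adj
    loopless  : ∀ v → ¬ Adj v v

open Graph public

Connected : ∀ {n} → Graph n → Set
Connected G = ∀ u v → Star (Adj G) u v

degree : ∀ {n} → Graph n → Fin n → ℕ
degree {n} G v = length (filter (adj? G v) (allFin n))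

IsHom : ∀ {h n} → Graph h → Graph n → Pred (Fin h → Fin n) 0ℓ
IsHom H G φ = ∀ u v → Adj H u v → Adj G (φ u) (φ v)

isHom? : ∀ {h n} (H : Graph h) (G : Graph n) φ → Dec (IsHom H G φ)
isHom? H G φ = all? λ u → all? λ v → adj? H u v →-dec adj? G (φ u) (φ v)

-- finToFun enumerates each map Fin h → Fin n exactly once.

Hom : ∀ {h n} → Graph h → Graph n → List (Fin h → Fin n)
Hom {h} {n} H G = filter (isHom? H G) (map finToFun (allFin (n ℕ.^ h)))

hom : ∀ {h n} → ℝ≥0 → (Fin h → ℝ≥0) → (H : Graph h) → Fin h → Graph n → ℝ≥0
hom {h} Δ α H o G = ∑ (Hom H G) λ φ →
  𝟙 (Δ ≤ fromℕ (degree G (φ o))) * ∏ (allFin h) λ w → degree G (φ w) ^ α w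

{-# OPTIONS --safe #-}

-- By distributivity a product of monotone functions of the degrees is a
-- non-negative combination of products of step functions, and such a product of
-- steps is at most its factor with the highest threshold, at some vertex w of a
-- spanning tree.  Rerooting the tree at w and summing out a leaf ≠ w leaves a
-- smaller tree with an extra monotone factor, the degree at the leaf's neighbour.
-- This proves the bound for monotone rational weights.  For real exponents, a
-- rational below the left side is already below the sum for suitable monotone
-- rational minorants of the factors d ^ α_w and of the indicator.

module Submission where

open import Defs
open import Algebra.Bundles using (CommutativeRing)
import Algebra.Properties.CommutativeSemigroup as CommutativeSemigroup
import Algebra.Properties.CommutativeSemiring.Exp as CommutativeSemiringExp
import Algebra.Properties.Semiring.Sum as SemiringSum
open import Data.Fin.Base using (Fin; zero; suc; combine; finToFun; _↑ˡ_; _↑ʳ_)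
import Data.Fin.Properties as Fin
open import Data.Integer.Base as ℤ using (+_)
import Data.Integer.Properties as ℤ
open import Data.List.Base using (List; []; _∷_; allFin; filter; foldr; length; map; tabulate)
open import Data.List.Properties using (length-filter; length-tabulate)
open import Data.Maybe.Base using (Maybe; just; nothing)
open import Data.Maybe.Properties using (≡-dec)
open import Data.Nat.Base as ℕ using (ℕ; zero; suc; _∸_)
import Data.Nat.Properties as ℕ
open import Data.Product.Base using (∃; ∃₂; _×_; _,_; proj₁; proj₂)
open import Data.Rational.Base as ℚ using (ℚ; 0ℚ; 1ℚ; _/_)
import Data.Rational.Properties as ℚ
import Data.Rational.Unnormalised.Base as ℚᵘ
import Data.Rational.Unnormalised.Properties as ℚᵘ
open import Data.Sum.Base using (_⊎_; inj₁; inj₂; [_,_])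
open import Data.Vec.Functional using (updateAt) renaming (_∷_ to cons)
open import Data.Vec.Functional.Properties using (updateAt-updates; updateAt-minimal)
open import Function.Base using (_∘_; const; id)
open import Level using (0ℓ)
open import Relation.Binary.Construct.Closure.ReflexiveTransitive using (Star; ε; _◅_)
open import Relation.Binary.PropositionalEquality
  using (_≡_; _≗_; refl; sym; trans; cong; cong₂; subst; subst₂; module ≡-Reasoning)
open import Relation.Nullary using (Dec; yes; no; ¬_; contradiction; map′; _⊎-dec_; _×-dec_)
open import Relation.Unary using (Pred; _∈_; _≐_; Decidable)

private
  module ℚ-ring = CommutativeRing ℚ.+-*-commutativeRing
  module Sum = SemiringSum ℚ-ring.semiring
  module Exp = CommutativeSemiringExp ℚ-ring.commutativeSemiring

open CommutativeSemigroup ℚ-ring.*-commutativeSemigroup using (x∙yz≈y∙xz; x∙yz≈xz∙y)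
open Sum using (sum)

-- Rational arithmetic

/-+ : ∀ m n m′ n′ →
  + m / suc n ℚ.+ + m′ / suc n′ ≡ + (m ℕ.* suc n′ ℕ.+ m′ ℕ.* suc n) / (suc n ℕ.* suc n′)
/-+ m n m′ n′ = ℚ.toℚᵘ-injective (begin
  ℚ.toℚᵘ (+ m / suc n ℚ.+ + m′ / suc n′)
    ≈⟨ ℚ.toℚᵘ-homo-+ (+ m / suc n) (+ m′ / suc n′) ⟩
  ℚ.toℚᵘ (+ m / suc n) ℚᵘ.+ ℚ.toℚᵘ (+ m′ / suc n′)
    ≈⟨ ℚᵘ.+-cong (ℚ.toℚᵘ-fromℚᵘ (ℚᵘ.mkℚᵘ (+ m) n)) (ℚ.toℚᵘ-fromℚᵘ (ℚᵘ.mkℚᵘ (+ m′) n′)) ⟩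
  ℚᵘ.mkℚᵘ (+ m) n ℚᵘ.+ ℚᵘ.mkℚᵘ (+ m′) n′
    ≡⟨ cong (λ i → ℚᵘ.mkℚᵘ i (ℕ.pred (suc n ℕ.* suc n′)))
         (sym (cong₂ ℤ._+_ (ℤ.pos-* m (suc n′)) (ℤ.pos-* m′ (suc n)))) ⟩
  ℚᵘ.mkℚᵘ (+ (m ℕ.* suc n′ ℕ.+ m′ ℕ.* suc n)) (ℕ.pred (suc n ℕ.* suc n′))
    ≈⟨ ℚ.toℚᵘ-fromℚᵘ (ℚᵘ.mkℚᵘ (+ (m ℕ.* suc n′ ℕ.+ m′ ℕ.* suc n)) (ℕ.pred (suc n ℕ.* suc n′))) ⟨
  ℚ.toℚᵘ (+ (m ℕ.* suc n′ ℕ.+ m′ ℕ.* suc n) / (suc n ℕ.* suc n′)) ∎)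
  where open ℚᵘ.≃-Reasoning

ℕ→ℚ-+ : ∀ m n → ℕ→ℚ (m ℕ.+ n) ≡ ℕ→ℚ m ℚ.+ ℕ→ℚ n
ℕ→ℚ-+ m n = sym (trans (/-+ m 0 n 0)
  (cong (_/ 1) (cong +_ (cong₂ ℕ._+_ (ℕ.*-identityʳ m) (ℕ.*-identityʳ n)))))

ℕ→ℚ-* : ∀ m n → ℕ→ℚ (m ℕ.* n) ≡ ℕ→ℚ m ℚ.* ℕ→ℚ n
ℕ→ℚ-* zero    n = sym (ℚ.*-zeroˡ (ℕ→ℚ n))
ℕ→ℚ-* (suc m) n = begin
  ℕ→ℚ (n ℕ.+ m ℕ.* n)                ≡⟨ ℕ→ℚ-+ n (m ℕ.* n) ⟩
  ℕ→ℚ n ℚ.+ ℕ→ℚ (m ℕ.* n)            ≡⟨ cong₂ ℚ._+_ (sym (ℚ.*-identityˡ (ℕ→ℚ n))) (ℕ→ℚ-* m n) ⟩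
  1ℚ ℚ.* ℕ→ℚ n ℚ.+ ℕ→ℚ m ℚ.* ℕ→ℚ n   ≡⟨ ℚ.*-distribʳ-+ (ℕ→ℚ n) 1ℚ (ℕ→ℚ m) ⟨
  (1ℚ ℚ.+ ℕ→ℚ m) ℚ.* ℕ→ℚ n           ≡⟨ cong (ℚ._* ℕ→ℚ n) (ℕ→ℚ-+ 1 m) ⟨
  ℕ→ℚ (suc m) ℚ.* ℕ→ℚ n              ∎
  where open ≡-Reasoning

ℕ→ℚ-mono : ∀ {m n} → m ℕ.≤ n → ℕ→ℚ m ℚ.≤ ℕ→ℚ n
ℕ→ℚ-mono {m} {n} m≤n = begin
  ℕ→ℚ m                    ≡⟨ ℚ.+-identityʳ (ℕ→ℚ m) ⟨
  ℕ→ℚ m ℚ.+ 0ℚ             ≤⟨ ℚ.+-monoʳ-≤ (ℕ→ℚ m) (0≤ℕ→ℚ (n ∸ m)) ⟩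
  ℕ→ℚ m ℚ.+ ℕ→ℚ (n ∸ m)    ≡⟨ ℕ→ℚ-+ m (n ∸ m) ⟨
  ℕ→ℚ (m ℕ.+ (n ∸ m))      ≡⟨ cong ℕ→ℚ (ℕ.m+[n∸m]≡n m≤n) ⟩
  ℕ→ℚ n                    ∎
  where open ℚ.≤-Reasoning

0≤1 : 0ℚ ℚ.≤ 1ℚ
0≤1 = 0≤ℕ→ℚ 1

0≤-* : ∀ {p q} → 0ℚ ℚ.≤ p → 0ℚ ℚ.≤ q → 0ℚ ℚ.≤ p ℚ.* q
0≤-* 0≤p 0≤q = *-mono {0ℚ} {0ℚ} ℚ.≤-refl 0≤p 0≤p 0≤q

*-monoʳ : ∀ {p q r} → 0ℚ ℚ.≤ p → q ℚ.≤ r → p ℚ.* q ℚ.≤ p ℚ.* r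
*-monoʳ {p} 0≤p = ℚ.*-monoˡ-≤-nonNeg p ⦃ ℚ.nonNegative 0≤p ⦄

0≤-minus : ∀ {p q} → p ℚ.≤ q → 0ℚ ℚ.≤ q ℚ.- p
0≤-minus {p} {q} p≤q = subst (ℚ._≤ q ℚ.- p) (ℚ.+-inverseʳ p) (ℚ.+-monoˡ-≤ (ℚ.- p) p≤q)

+-minus : ∀ p q → p ℚ.+ (q ℚ.- p) ≡ q
+-minus p q = begin
  p ℚ.+ (q ℚ.+ ℚ.- p)   ≡⟨ cong (p ℚ.+_) (ℚ.+-comm q (ℚ.- p)) ⟩
  p ℚ.+ (ℚ.- p ℚ.+ q)   ≡⟨ ℚ.+-assoc p (ℚ.- p) q ⟨
  (p ℚ.- p) ℚ.+ q       ≡⟨ cong (ℚ._+ q) (ℚ.+-inverseʳ p) ⟩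
  0ℚ ℚ.+ q              ≡⟨ ℚ.+-identityˡ q ⟩
  q                     ∎
  where open ≡-Reasoning

sum-mono : ∀ {n} {f g : Fin n → ℚ} → (∀ i → f i ℚ.≤ g i) → sum f ℚ.≤ sum g
sum-mono {zero}  f≤g = ℚ.≤-refl
sum-mono {suc n} f≤g = ℚ.+-mono-≤ (f≤g zero) (sum-mono (f≤g ∘ suc))

sum-const : ∀ n c → sum {n} (const c) ≡ ℕ→ℚ n ℚ.* c
sum-const zero    c = sym (ℚ.*-zeroˡ c)
sum-const (suc n) c = begin
  c ℚ.+ sum {n} (const c)       ≡⟨ cong₂ ℚ._+_ (sym (ℚ.*-identityˡ c)) (sum-const n c) ⟩
  1ℚ ℚ.* c ℚ.+ ℕ→ℚ n ℚ.* c      ≡⟨ ℚ.*-distribʳ-+ c 1ℚ (ℕ→ℚ n) ⟨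
  (1ℚ ℚ.+ ℕ→ℚ n) ℚ.* c          ≡⟨ cong (ℚ._* c) (ℕ→ℚ-+ 1 n) ⟨
  ℕ→ℚ (suc n) ℚ.* c             ∎
  where open ≡-Reasoning

sum-++ : ∀ m n (f : Fin (m ℕ.+ n) → ℚ) → sum f ≡ sum (λ i → f (i ↑ˡ n)) ℚ.+ sum (λ j → f (m ↑ʳ j))
sum-++ zero    n f = sym (ℚ.+-identityˡ (sum f))
sum-++ (suc m) n f = trans (cong (f zero ℚ.+_) (sum-++ m n (f ∘ suc)))
  (sym (ℚ.+-assoc (f zero) _ _))

sum-combine : ∀ m n (f : Fin (m ℕ.* n) → ℚ) → sum f ≡ sum (λ i → sum (λ j → f (combine {m} i j)))
sum-combine zero    n f = refl
sum-combine (suc m) n f = trans (sum-++ n (m ℕ.* n) f)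
  (cong (sum (λ j → f (j ↑ˡ m ℕ.* n)) ℚ.+_) (sum-combine m n (λ k → f (n ↑ʳ k))))

-- Sums over all maps

-- `finToFun (combine a j)` and `cons a (finToFun j)` agree only pointwise, so rearranging sums over
-- maps needs summands that respect pointwise equality.
Extensional : ∀ {h n} → ((Fin h → Fin n) → ℚ) → Set
Extensional K = ∀ φ ψ → φ ≗ ψ → K φ ≡ K ψ

∑maps : ∀ {h n} → ((Fin h → Fin n) → ℚ) → ℚ
∑maps {h} {n} K = sum {n ℕ.^ h} (K ∘ finToFun)

∑maps-suc : ∀ {h n} {K : (Fin (suc h) → Fin n) → ℚ} → Extensional K →
  ∑maps K ≡ sum (λ a → ∑maps (λ φ → K (cons a φ)))
∑maps-suc {h} {n} {K} ext = trans (sum-combine n (n ℕ.^ h) (K ∘ finToFun))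
  (Sum.sum-cong-≗ λ a → Sum.sum-cong-≗ λ j → ext (finToFun (combine a j)) (cons a (finToFun j)) λ
    { zero    → cong proj₁ (Fin.remQuot-combine {n} {n ℕ.^ h} a j)
    ; (suc i) → cong (λ p → finToFun {n} {h} (proj₂ p) i) (Fin.remQuot-combine {n} {n ℕ.^ h} a j) })

updateAt-cong : ∀ {h n} (u : Fin h) {φ ψ : Fin h → Fin n} {a : Fin n} → φ ≗ ψ →
  updateAt φ u (const a) ≗ updateAt ψ u (const a)
updateAt-cong zero    φ≗ψ zero    = refl
updateAt-cong zero    φ≗ψ (suc i) = φ≗ψ (suc i)
updateAt-cong (suc u) φ≗ψ zero    = φ≗ψ zero
updateAt-cong (suc u) φ≗ψ (suc i) = updateAt-cong u (φ≗ψ ∘ suc) i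

resample-extensional : ∀ {h n} (u : Fin h) {K : (Fin h → Fin n) → ℚ} → Extensional K →
  Extensional (λ φ → sum (λ a → K (updateAt φ u (const a))))
resample-extensional {n = n} u ext φ ψ φ≗ψ = Sum.sum-cong-≗ {n} λ a →
  ext (updateAt φ u (const a)) (updateAt ψ u (const a)) (updateAt-cong u φ≗ψ)

-- Resampling the coordinate u: this sums out a vertex while keeping the vertex
-- set Fin h fixed, at the cost of a factor n.
∑maps-resample : ∀ {h n} (u : Fin h) {K : (Fin h → Fin n) → ℚ} → Extensional K →
  ℕ→ℚ n ℚ.* ∑maps K ≡ ∑maps (λ φ → sum (λ a → K (updateAt φ u (const a))))
∑maps-resample {suc h} {n} zero {K} ext = begin
  ℕ→ℚ n ℚ.* ∑maps K
    ≡⟨ cong (ℕ→ℚ n ℚ.*_) (trans (∑maps-suc ext) (Sum.∑-comm {n} {n ℕ.^ h} λ a i → K (cons a (finToFun i)))) ⟩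
  ℕ→ℚ n ℚ.* ∑maps (λ φ → sum (λ a → K (cons a φ)))
    -- The factor `n` is spread over the old values `b` of the coordinate `zero`, which resampling
    -- then overwrites.
    ≡⟨ sum-const n _ ⟨
  sum {n} (λ b → ∑maps (λ φ → sum (λ a → K (cons a φ))))
    ≡⟨ Sum.sum-cong-≗ {n} (λ b → Sum.sum-cong-≗ {n ℕ.^ h} λ i → Sum.sum-cong-≗ {n} λ a →
         ext (cons a (finToFun i)) (updateAt (cons b (finToFun i)) zero (const a))
           λ { zero → refl ; (suc _) → refl }) ⟩
  sum {n} (λ b → ∑maps (λ φ → sum (λ a → K (updateAt (cons b φ) zero (const a)))))
    ≡⟨ ∑maps-suc (resample-extensional zero ext) ⟨
  ∑maps (λ φ → sum (λ a → K (updateAt φ zero (const a)))) ∎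
  where open ≡-Reasoning
∑maps-resample {suc h} {n} (suc u) {K} ext = begin
  ℕ→ℚ n ℚ.* ∑maps K
    ≡⟨ cong (ℕ→ℚ n ℚ.*_) (∑maps-suc ext) ⟩
  ℕ→ℚ n ℚ.* sum (λ b → ∑maps (λ φ → K (cons b φ)))
    ≡⟨ Sum.*-distribˡ-sum {n} (ℕ→ℚ n) _ ⟩
  sum (λ b → ℕ→ℚ n ℚ.* ∑maps (λ φ → K (cons b φ)))
    ≡⟨ Sum.sum-cong-≗ {n} (λ b → ∑maps-resample u λ φ ψ φ≗ψ → ext (cons b φ) (cons b ψ) λ { zero → refl ; (suc i) → φ≗ψ i }) ⟩
  sum (λ b → ∑maps (λ φ → sum (λ a → K (cons b (updateAt φ u (const a))))))
    ≡⟨ Sum.sum-cong-≗ {n} (λ b → Sum.sum-cong-≗ {n ℕ.^ h} λ i → Sum.sum-cong-≗ {n} λ a →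
         ext (cons b (updateAt (finToFun i) u (const a))) (updateAt (cons b (finToFun i)) (suc u) (const a))
           λ { zero → refl ; (suc _) → refl }) ⟩
  sum (λ b → ∑maps (λ φ → sum (λ a → K (updateAt (cons b φ) (suc u) (const a)))))
    ≡⟨ ∑maps-suc (resample-extensional (suc u) ext) ⟨
  ∑maps (λ φ → sum (λ a → K (updateAt φ (suc u) (const a)))) ∎
  where open ≡-Reasoning

-- Monotone functions and the layer cake

record Monotone : Set where
  field
    at     : ℕ → ℚ
    0≤at   : ∀ k → 0ℚ ℚ.≤ at k
    mono   : ∀ {k l} → k ℕ.≤ l → at k ℚ.≤ at l

open Monotone

𝕀 : ∀ {P : Set} → Dec P → ℚ
𝕀 (yes _) = 1ℚ
𝕀 (no  _) = 0ℚ

0≤𝕀 : ∀ {P : Set} (P? : Dec P) → 0ℚ ℚ.≤ 𝕀 P?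
0≤𝕀 (yes _) = 0≤1
0≤𝕀 (no  _) = ℚ.≤-refl

𝕀≤1 : ∀ {P : Set} (P? : Dec P) → 𝕀 P? ℚ.≤ 1ℚ
𝕀≤1 (yes _) = ℚ.≤-refl
𝕀≤1 (no  _) = 0≤1

𝕀-mono : ∀ {P Q : Set} (P? : Dec P) (Q? : Dec Q) → (P → Q) → 𝕀 P? ℚ.≤ 𝕀 Q?
𝕀-mono (yes p) (yes q) P→Q = ℚ.≤-refl
𝕀-mono (yes p) (no ¬q) P→Q = contradiction (P→Q p) ¬q
𝕀-mono (no ¬p) Q?      P→Q = 0≤𝕀 Q?

𝕀-true : ∀ {P : Set} (P? : Dec P) → P → 𝕀 P? ≡ 1ℚ
𝕀-true (yes _) _ = refl
𝕀-true (no ¬p) p = contradiction p ¬p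

step : ℕ → Monotone
step s = record
  { at   = λ k → 𝕀 (s ℕ.≤? k)
  ; 0≤at = λ k → 0≤𝕀 (s ℕ.≤? k)
  ; mono = λ {k} {l} k≤l → 𝕀-mono (s ℕ.≤? k) (s ℕ.≤? l) (λ s≤k → ℕ.≤-trans s≤k k≤l)
  }

natural : Monotone
natural = record { at = ℕ→ℚ ; 0≤at = 0≤ℕ→ℚ ; mono = ℕ→ℚ-mono }

-- `local` confines `X` to arguments in [0 , N], which makes the layer cake a finite sum; in the
-- application these arguments are degrees.
record Linear (N : ℕ) (X : (ℕ → ℚ) → ℚ) : Set where
  field
    additive    : ∀ f g → X (λ k → f k ℚ.+ g k) ≡ X f ℚ.+ X g
    homogeneous : ∀ c f → X (λ k → c ℚ.* f k) ≡ c ℚ.* X f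
    local       : ∀ {f g} → (∀ {k} → k ℕ.≤ N → f k ≡ g k) → X f ≡ X g

open Linear

linear-* : ∀ {N X} c → Linear N X → Linear N (λ f → c ℚ.* X f)
linear-* {X = X} c lin = record
  { additive    = λ f g → trans (cong (c ℚ.*_) (additive lin f g)) (ℚ.*-distribˡ-+ c (X f) (X g))
  ; homogeneous = λ d f → trans (cong (c ℚ.*_) (homogeneous lin d f)) (x∙yz≈y∙xz c d (X f))
  ; local       = λ f≗g → cong (c ℚ.*_) (local lin f≗g)
  }

linear-sum : ∀ {N m} {X : Fin m → (ℕ → ℚ) → ℚ} → (∀ i → Linear N (X i)) →
  Linear N (λ f → sum (λ i → X i f))
linear-sum {m = m} {X} lin = record
  { additive    = λ f g → trans (Sum.sum-cong-≗ {m} λ i → additive (lin i) f g)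
                    (Sum.∑-distrib-+ {m} (λ i → X i f) (λ i → X i g))
  ; homogeneous = λ c f → trans (Sum.sum-cong-≗ {m} λ i → homogeneous (lin i) c f)
                    (sym (Sum.*-distribˡ-sum {m} c (λ i → X i f)))
  ; local       = λ f≗g → Sum.sum-cong-≗ {m} λ i → local (lin i) f≗g
  }

-- A monotone function is a non-negative combination of step functions on
-- [0 , N]: f (k ⊓ suc N) − f (k ⊓ N) = (f (suc N) − f N) · step (suc N) k.
layer-cake : ∀ {N X Y} → Linear N X → Linear N Y →
  (∀ s → X (at (step s)) ℚ.≤ Y (at (step s))) → ∀ f → X (at f) ℚ.≤ Y (at f)
layer-cake {N} {X} {Y} linX linY X≤Y f =
  -- Truncating at `N` changes nothing on [0 , N], so induction on the truncation level reaches `f`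
  -- itself.
  subst₂ ℚ._≤_ (local linX untruncate) (local linY untruncate) (truncated N)
  where
  untruncate : ∀ {k} → k ℕ.≤ N → at f (k ℕ.⊓ N) ≡ at f k
  untruncate k≤N = cong (at f) (ℕ.m≤n⇒m⊓n≡m k≤N)
  scaled : ∀ {c} → 0ℚ ℚ.≤ c → ∀ s → X (λ k → c ℚ.* at (step s) k) ℚ.≤ Y (λ k → c ℚ.* at (step s) k)
  scaled {c} 0≤c s = subst₂ ℚ._≤_ (sym (homogeneous linX c (at (step s))))
    (sym (homogeneous linY c (at (step s)))) (*-monoʳ 0≤c (X≤Y s))
  increment : ℕ → ℚ
  increment M = at f (suc M) ℚ.- at f M
  layer : ∀ M k → at f (k ℕ.⊓ M) ℚ.+ increment M ℚ.* at (step (suc M)) k ≡ at f (k ℕ.⊓ suc M)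
  layer M k with suc M ℕ.≤? k
  ... | yes M<k = begin
    at f (k ℕ.⊓ M) ℚ.+ increment M ℚ.* 1ℚ
      ≡⟨ cong₂ ℚ._+_ (cong (at f) (ℕ.m≥n⇒m⊓n≡n (ℕ.<⇒≤ M<k))) (ℚ.*-identityʳ (increment M)) ⟩
    at f M ℚ.+ increment M
      ≡⟨ +-minus (at f M) (at f (suc M)) ⟩
    at f (suc M)
      ≡⟨ cong (at f) (ℕ.m≥n⇒m⊓n≡n M<k) ⟨
    at f (k ℕ.⊓ suc M) ∎
    where open ≡-Reasoning
  ... | no M≮k = begin
    at f (k ℕ.⊓ M) ℚ.+ increment M ℚ.* 0ℚ
      ≡⟨ cong₂ ℚ._+_ (cong (at f) (ℕ.m≤n⇒m⊓n≡m k≤M)) (ℚ.*-zeroʳ (increment M)) ⟩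
    at f k ℚ.+ 0ℚ
      ≡⟨ ℚ.+-identityʳ (at f k) ⟩
    at f k
      ≡⟨ cong (at f) (ℕ.m≤n⇒m⊓n≡m (ℕ.m≤n⇒m≤1+n k≤M)) ⟨
    at f (k ℕ.⊓ suc M) ∎
    where
    open ≡-Reasoning
    k≤M = ℕ.≮⇒≥ M≮k
  truncated : ∀ M → X (λ k → at f (k ℕ.⊓ M)) ℚ.≤ Y (λ k → at f (k ℕ.⊓ M))
  -- The bottom layer is the constant `at f 0`, a multiple of `step 0`, which is identically 1.
  truncated zero = subst₂ ℚ._≤_ (local linX constant) (local linY constant) (scaled (0≤at f 0) 0)
    where
    constant : ∀ {k} → k ℕ.≤ N → at f 0 ℚ.* 1ℚ ≡ at f (k ℕ.⊓ 0)
    constant {k} _ = trans (ℚ.*-identityʳ (at f 0)) (cong (at f) (sym (ℕ.⊓-zeroʳ k)))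
  truncated (suc M) = subst₂ ℚ._≤_ (split linX) (split linY)
    (ℚ.+-mono-≤ (truncated M) (scaled (0≤-minus (mono f (ℕ.n≤1+n M))) (suc M)))
    where
    split : ∀ {Z} → Linear N Z →
      Z (λ k → at f (k ℕ.⊓ M)) ℚ.+ Z (λ k → increment M ℚ.* at (step (suc M)) k)
        ≡ Z (λ k → at f (k ℕ.⊓ suc M))
    split linZ = trans (sym (additive linZ _ _)) (local linZ λ {k} _ → layer M k)

-- Spanning trees

module _ {h : ℕ} (H : Graph h) where

  -- Trees in H with m edges, root w and vertex set P.
  data Tree : ℕ → Fin h → Pred (Fin h) 0ℓ → Set₁ where
    single : ∀ {w P} → P ≐ (_≡ w) → Tree 0 w P
    grow   : ∀ {m w x u P Q} → Tree m w P → P x → Adj H x u → ¬ P u →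
             Q ≐ (λ z → z ≡ u ⊎ P z) → Tree (suc m) w Q

  root∈ : ∀ {m w P} → Tree m w P → P w
  root∈ (single (_ , w⊆P))              = w⊆P refl
  root∈ (grow t x∈P x∼u u∉P (_ , u∪P⊆Q)) = u∪P⊆Q (inj₂ (root∈ t))

  -- The new root must come first in the order of growth: the edge at the old root is reversed in
  -- the `single` case, and the later growth steps are replayed on top of it.
  plant : ∀ {m x u P Q} → Tree m x P → Adj H x u → ¬ P u →
    Q ≐ (λ z → z ≡ u ⊎ P z) → Tree (suc m) u Q
  plant (single (P⊆x , x⊆P)) x∼u u∉P (Q⊆ , ⊆Q) =
    grow (single (id , id)) refl (symmetric H x∼u) (λ { refl → u∉P (x⊆P refl) })
      ( (λ z∈Q → [ inj₂ , (λ z∈P → inj₁ (P⊆x z∈P)) ] (Q⊆ z∈Q))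
      , [ (λ { refl → ⊆Q (inj₂ (x⊆P refl)) }) , (λ z≡u → ⊆Q (inj₁ z≡u)) ])
  plant (grow t x′∈P x′∼u′ u′∉P (P⊆ , ⊆P)) x∼u u∉P (Q⊆ , ⊆Q) =
    grow (plant t x∼u (λ u∈ → u∉P (⊆P (inj₂ u∈))) (id , id)) (inj₂ x′∈P) x′∼u′
      [ (λ { refl → u∉P (⊆P (inj₁ refl)) }) , u′∉P ]
      ( (λ z∈Q → [ (λ z≡u → inj₂ (inj₁ z≡u))
                 , (λ z∈P → [ inj₁ , (λ z∈ → inj₂ (inj₂ z∈)) ] (P⊆ z∈P)) ] (Q⊆ z∈Q))
      , [ (λ z≡u′ → ⊆Q (inj₂ (⊆P (inj₁ z≡u′))))
        , [ (λ z≡u → ⊆Q (inj₁ z≡u)) , (λ z∈ → ⊆Q (inj₂ (⊆P (inj₂ z∈)))) ] ])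

  -- If `y` is the vertex grown last, the smaller tree is rerooted at the neighbour of `y` and `y`
  -- is planted below it. Otherwise the smaller tree is rerooted at `y` and the last vertex is grown
  -- again.
  reroot : ∀ {m w y P} → Tree m w P → P y → Tree m y P
  reroot (single P≐w@(P⊆w , _)) y∈P with refl ← P⊆w y∈P = single P≐w
  reroot (grow t x∈P x∼u u∉P Q≐@(Q⊆ , _)) y∈Q with Q⊆ y∈Q
  ... | inj₁ refl = plant (reroot t x∈P) x∼u u∉P Q≐
  ... | inj₂ y∈P  = grow (reroot t y∈P) x∈P x∼u u∉P Q≐

  vertex? : ∀ {m w P} → Tree m w P → Decidable P
  vertex? {w = w} (single (P⊆w , w⊆P)) z = map′ w⊆P P⊆w (z Fin.≟ w)
  vertex? (grow {u = u} t _ _ _ (Q⊆ , ⊆Q)) z = map′ ⊆Q Q⊆ (z Fin.≟ u ⊎-dec vertex? t z)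

  -- Position in the order of growth. Its injectivity bounds the size of `P` above by `suc m`; the
  -- inverse enumeration `node` gives the lower bound.
  rank : ∀ {m w P z} → Tree m w P → P z → Fin (suc m)
  rank (single _) _ = zero
  rank (grow t _ _ _ (Q⊆ , _)) z∈Q = [ const zero , (λ z∈P → suc (rank t z∈P)) ] (Q⊆ z∈Q)

  rank-injective : ∀ {m w P y z} (t : Tree m w P) (y∈P : P y) (z∈P : P z) →
    rank t y∈P ≡ rank t z∈P → y ≡ z
  rank-injective (single (P⊆w , _)) y∈P z∈P _ = trans (P⊆w y∈P) (sym (P⊆w z∈P))
  rank-injective (grow t _ _ _ (Q⊆ , _)) y∈Q z∈Q eq with Q⊆ y∈Q | Q⊆ z∈Q
  ... | inj₁ y≡u | inj₁ z≡u = trans y≡u (sym z≡u)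
  ... | inj₁ _   | inj₂ _   = contradiction eq λ ()
  ... | inj₂ _   | inj₁ _   = contradiction eq λ ()
  ... | inj₂ y∈P | inj₂ z∈P = rank-injective t y∈P z∈P (Fin.suc-injective eq)

  -- Pigeonhole: if every vertex were in `P`, `rank` would inject `Fin h` into the smaller
  -- `Fin (suc m)`.
  missing-vertex : ∀ {m w P} → Tree m w P → suc m ℕ.< h → ∃ λ z → ¬ P z
  missing-vertex {P = P} t m<h = Fin.¬∀⟶∃¬ h P (vertex? t) λ all →
    ℕ.<⇒≱ m<h (Fin.injective⇒≤ λ {y} {z} → rank-injective t (all y) (all z))

  node : ∀ {m w P} → Tree m w P → Fin (suc m) → Fin h
  node (single {w} _) _ = w
  node (grow {u = u} t _ _ _ _) zero    = u
  node (grow t _ _ _ _)         (suc i) = node t i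

  node∈ : ∀ {m w P} (t : Tree m w P) i → P (node t i)
  node∈ (single (_ , w⊆P)) _ = w⊆P refl
  node∈ (grow t _ _ _ (_ , ⊆Q)) zero    = ⊆Q (inj₁ refl)
  node∈ (grow t _ _ _ (_ , ⊆Q)) (suc i) = ⊆Q (inj₂ (node∈ t i))

  node-injective : ∀ {m w P} (t : Tree m w P) {i j} → node t i ≡ node t j → i ≡ j
  node-injective (single _) {zero} {zero} _ = refl
  node-injective (grow t _ _ u∉P _) {zero}  {zero}  _  = refl
  node-injective (grow t _ _ u∉P _) {zero}  {suc j} refl = contradiction (node∈ t j) u∉P
  node-injective (grow t _ _ u∉P _) {suc i} {zero}  refl = contradiction (node∈ t i) u∉P
  node-injective (grow t _ _ u∉P _) {suc i} {suc j} eq = cong suc (node-injective t eq)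

  -- A vertex outside `P`, together with the `suc m` nodes of the tree, would give more than `h`
  -- distinct vertices.
  spanning : ∀ {m w P} → Tree m w P → h ℕ.≤ suc m → ∀ z → P z
  spanning {m} {P = P} t h≤m z with vertex? t z
  ... | yes z∈P = z∈P
  ... | no  z∉P = contradiction h≤m (ℕ.<⇒≱ (Fin.injective⇒≤ {f = nodes} injective))
    where
    nodes : Fin (suc (suc m)) → Fin h
    nodes zero    = z
    nodes (suc i) = node t i
    injective : ∀ {i j} → nodes i ≡ nodes j → i ≡ j
    injective {zero}  {zero}  _  = refl
    injective {zero}  {suc j} eq = contradiction (subst P (sym eq) (node∈ t j)) z∉P
    injective {suc i} {zero}  eq = contradiction (subst P eq (node∈ t i)) z∉P
    injective {suc i} {suc j} eq = cong suc (node-injective t eq)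

  -- The first edge of the path that leaves `P` will do.
  crossing-edge : ∀ {P : Pred (Fin h) 0ℓ} {y z} → Decidable P → P y → ¬ P z → Star (Adj H) y z →
    ∃₂ λ x u → P x × ¬ P u × Adj H x u
  crossing-edge P? y∈P z∉P ε = contradiction y∈P z∉P
  crossing-edge P? y∈P z∉P (_◅_ {j = u} y∼u path) with P? u
  ... | yes u∈P = crossing-edge P? u∈P z∉P path
  ... | no  u∉P = _ , u , y∈P , u∉P , y∼u

  -- As long as a vertex is missing, a path from the root to it leaves the tree along an edge by
  -- which the tree can grow.
  tree : Connected H → ∀ w m → m ℕ.< h → ∃ λ P → Tree m w P
  tree conn w zero    _   = (_≡ w) , single (id , id)
  tree conn w (suc m) m<h =
    let P , t = tree conn w m (ℕ.<-trans (ℕ.n<1+n m) m<h)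
        z , z∉P = missing-vertex t m<h
        x , u , x∈P , u∉P , x∼u = crossing-edge (vertex? t) (root∈ t) z∉P (conn w z)
    in (λ z → z ≡ u ⊎ P z) , grow t x∈P x∼u u∉P (id , id)

-- Weighted counts of tree homomorphisms

count-filter : ∀ {A : Set} {P : A → Set} (P? : ∀ x → Dec (P x)) {n} (f : Fin n → A) →
  ℕ→ℚ (length (filter P? (tabulate f))) ≡ sum (λ i → 𝕀 (P? (f i)))
count-filter P? {zero}  f = refl
count-filter P? {suc n} f with P? (f zero)
... | yes _ = trans (ℕ→ℚ-+ 1 (length (filter P? (tabulate (f ∘ suc)))))
                (cong (1ℚ ℚ.+_) (count-filter P? (f ∘ suc)))
... | no  _ = trans (count-filter P? (f ∘ suc)) (sym (ℚ.+-identityˡ _))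

-- One factor of a product of functions of the degrees. `inside` places its vertex in the tree, so
-- that the tree can be rerooted there.
record Weight {h : ℕ} (P : Pred (Fin h) 0ℓ) : Set where
  constructor _at_⟨_⟩
  field
    fun    : Monotone
    vertex : Fin h
    inside : P vertex

∑maps-mono : ∀ {h n} {K L : (Fin h → Fin n) → ℚ} → (∀ φ → K φ ℚ.≤ L φ) → ∑maps K ℚ.≤ ∑maps L
∑maps-mono {h} {n} K≤L = sum-mono {n ℕ.^ h} (λ i → K≤L (finToFun i))

at-step-* : ∀ {s t} k → s ℕ.≤ t → at (step s) k ℚ.* at (step t) k ≡ at (step t) k
at-step-* {s} {t} k s≤t with t ℕ.≤? k
... | yes t≤k = trans (ℚ.*-identityʳ (at (step s) k)) (𝕀-true (s ℕ.≤? k) (ℕ.≤-trans s≤t t≤k))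
... | no  _   = ℚ.*-zeroʳ (at (step s) k)

drop-step : ∀ s k {q} → 0ℚ ℚ.≤ q → at (step s) k ℚ.* q ℚ.≤ q
drop-step s k {q} 0≤q = subst (at (step s) k ℚ.* q ℚ.≤_) (ℚ.*-identityˡ q)
  (ℚ.*-monoʳ-≤-nonNeg q ⦃ ℚ.nonNegative 0≤q ⦄ (𝕀≤1 (s ℕ.≤? k)))

update-outside : ∀ {h n} {P : Pred (Fin h) 0ℓ} {u} → ¬ P u → ∀ φ (a : Fin n) {z} → P z →
  updateAt φ u (const a) z ≡ φ z
update-outside {u = u} u∉P φ a {z} z∈P = updateAt-minimal z u φ λ { refl → u∉P z∈P }

module _ {n : ℕ} (G : Graph n) where

  adj : Fin n → Fin n → ℚ
  adj u v = 𝕀 (adj? G u v)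

  adj-sym : ∀ u v → adj u v ≡ adj v u
  adj-sym u v = ℚ.≤-antisym (𝕀-mono (adj? G u v) (adj? G v u) (symmetric G))
    (𝕀-mono (adj? G v u) (adj? G u v) (symmetric G))

  degℚ : Fin n → ℚ
  degℚ v = ℕ→ℚ (degree G v)

  sum-adj : ∀ v → sum (adj v) ≡ degℚ v
  sum-adj v = sym (count-filter (adj? G v) id)

  degree≤n : ∀ v → degree G v ℕ.≤ n
  degree≤n v = subst (degree G v ℕ.≤_) (length-tabulate id) (length-filter (adj? G v) (allFin n))

  weight : ∀ {h} {P : Pred (Fin h) 0ℓ} → List (Weight P) → (Fin h → Fin n) → ℚ
  weight []                  φ = 1ℚ
  weight ((f at x ⟨ _ ⟩) ∷ L) φ = at f (degree G (φ x)) ℚ.* weight L φ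

  0≤weight : ∀ {h} {P : Pred (Fin h) 0ℓ} (L : List (Weight P)) φ → 0ℚ ℚ.≤ weight L φ
  0≤weight []                  φ = 0≤1
  0≤weight ((f at x ⟨ _ ⟩) ∷ L) φ = 0≤-* (0≤at f _) (0≤weight L φ)

  stepped : ∀ {h} → ℕ → Fin h → ((Fin h → Fin n) → ℚ) → (Fin h → Fin n) → ℚ
  stepped s w K φ = at (step s) (degree G (φ w)) ℚ.* K φ

  module _ {h : ℕ} (H : Graph h) where

    edges : ∀ {m w P} → Tree H m w P → (Fin h → Fin n) → ℚ
    edges (single _) φ = 1ℚ
    edges (grow {x = x} {u} t _ _ _ _) φ = adj (φ x) (φ u) ℚ.* edges t φ

    0≤edges : ∀ {m w P} (t : Tree H m w P) φ → 0ℚ ℚ.≤ edges t φ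
    0≤edges (single _) φ = 0≤1
    0≤edges (grow t _ _ _ _) φ = 0≤-* (0≤𝕀 (adj? G _ _)) (0≤edges t φ)

    edges-hom : ∀ {m w P} (t : Tree H m w P) {φ} → IsHom H G φ → edges t φ ≡ 1ℚ
    edges-hom (single _) hom = refl
    edges-hom (grow t _ x∼u _ _) hom = cong₂ ℚ._*_ (𝕀-true (adj? G _ _) (hom _ _ x∼u)) (edges-hom t hom)

    edges-plant : ∀ {m x u P Q} (t : Tree H m x P) (x∼u : Adj H x u) (u∉P : ¬ P u)
      (Q≐ : Q ≐ (λ z → z ≡ u ⊎ P z)) φ →
      edges (plant H t x∼u u∉P Q≐) φ ≡ adj (φ x) (φ u) ℚ.* edges t φ
    edges-plant (single _) x∼u u∉P Q≐ φ = cong (ℚ._* 1ℚ) (adj-sym _ _)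
    edges-plant (grow t _ _ _ _) x∼u u∉P Q≐ φ =
      trans (cong (adj _ _ ℚ.*_) (edges-plant t _ _ _ φ)) (x∙yz≈y∙xz (adj _ _) (adj _ _) (edges t φ))

    -- Rerooting only reverses edges and reorders the product; adjacency in `G` is symmetric.
    edges-reroot : ∀ {m w y P} (t : Tree H m w P) (y∈P : P y) φ →
      edges (reroot H t y∈P) φ ≡ edges t φ
    edges-reroot (single (P⊆w , _)) y∈P φ with refl ← P⊆w y∈P = refl
    edges-reroot (grow t x∈P x∼u u∉P Q≐@(Q⊆ , _)) y∈Q φ with Q⊆ y∈Q
    ... | inj₁ refl = trans (edges-plant (reroot H t x∈P) _ _ _ φ)
                        (cong (adj _ _ ℚ.*_) (edges-reroot t x∈P φ))
    ... | inj₂ y∈P  = cong (adj _ _ ℚ.*_) (edges-reroot t y∈P φ)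

    edges-local : ∀ {m w P} (t : Tree H m w P) {φ ψ} → (∀ {z} → P z → φ z ≡ ψ z) → edges t φ ≡ edges t ψ
    edges-local (single _) φ≗ψ = refl
    edges-local (grow t x∈P _ _ (_ , ⊆Q)) φ≗ψ = cong₂ ℚ._*_
      (cong₂ adj (φ≗ψ (⊆Q (inj₂ x∈P))) (φ≗ψ (⊆Q (inj₁ refl))))
      (edges-local t (λ z∈P → φ≗ψ (⊆Q (inj₂ z∈P))))

    -- The sum runs over all maps from `Fin h`, so for `K` depending only on the tree the h - (m +
    -- 1) vertices outside it are free and contribute a power of `n`. The factors n^(m+1) and n^h
    -- account for this without a division. `K (const v)` is the weight when every vertex is sent to
    -- `v`.
    Bounded : ∀ {m w P} → Tree H m w P → ((Fin h → Fin n) → ℚ) → Set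
    Bounded {m} t K = ℕ→ℚ (n ℕ.^ suc m) ℚ.* ∑maps (λ φ → edges t φ ℚ.* K φ)
      ℚ.≤ ℕ→ℚ (n ℕ.^ h) ℚ.* sum (λ v → degℚ v ^ℚ m ℚ.* K (const v))

    -- Dropping a redundant step enlarges the weight on general maps but leaves it unchanged on
    -- constant ones, which are all that the right side sees.
    bounded-mono : ∀ {m w P} {t : Tree H m w P} {K L : (Fin h → Fin n) → ℚ} →
      (∀ φ → K φ ℚ.≤ L φ) → (∀ v → L (const v) ≡ K (const v)) → Bounded t L → Bounded t K
    bounded-mono {m} {t = t} {K} {L} K≤L L≡K bounded = begin
      ℕ→ℚ (n ℕ.^ suc m) ℚ.* ∑maps (λ φ → edges t φ ℚ.* K φ)
        ≤⟨ *-monoʳ (0≤ℕ→ℚ (n ℕ.^ suc m)) (∑maps-mono λ φ → *-monoʳ (0≤edges t φ) (K≤L φ)) ⟩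
      ℕ→ℚ (n ℕ.^ suc m) ℚ.* ∑maps (λ φ → edges t φ ℚ.* L φ)
        ≤⟨ bounded ⟩
      ℕ→ℚ (n ℕ.^ h) ℚ.* sum (λ v → degℚ v ^ℚ m ℚ.* L (const v))
        ≡⟨ cong (ℕ→ℚ (n ℕ.^ h) ℚ.*_) (Sum.sum-cong-≗ {n} λ v → cong (degℚ v ^ℚ m ℚ.*_) (L≡K v)) ⟩
      ℕ→ℚ (n ℕ.^ h) ℚ.* sum (λ v → degℚ v ^ℚ m ℚ.* K (const v)) ∎
      where open ℚ.≤-Reasoning

    -- By multilinearity all weights may be taken to be step functions; of two
    -- step functions, the one with the lower threshold can then be dropped.
    concentrate : ∀ {m w P} (t : Tree H m w P) →
      (∀ {y} → P y → ∀ s → Bounded t (stepped s y (const 1ℚ))) →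
      ∀ (L : List (Weight P)) {y} → P y → ∀ s → Bounded t (stepped s y (weight L))
    concentrate t single-step [] y∈P s = single-step y∈P s
    concentrate {m} t single-step ((f at x ⟨ x∈P ⟩) ∷ L) {y} y∈P s =
      -- Both sides are linear in the function of the first weight, and all degrees in `G` are at
      -- most `n`.
      layer-cake {N = n}
        (linear-* (ℕ→ℚ (n ℕ.^ suc m)) (linear-sum {m = n ℕ.^ h} λ i →
          linear-weight (edges t (finToFun i)) (finToFun i)))
        (linear-* (ℕ→ℚ (n ℕ.^ h)) (linear-sum {m = n} λ v → linear-weight (degℚ v ^ℚ m) (const v)))
        two-steps f
      where
      linear-weight : ∀ c φ → Linear n (λ g →
        c ℚ.* (at (step s) (degree G (φ y)) ℚ.* (g (degree G (φ x)) ℚ.* weight L φ)))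
      linear-weight c φ = linear-* c (linear-* (at (step s) (degree G (φ y))) record
        { additive    = λ g g′ → ℚ.*-distribʳ-+ (weight L φ) (g d) (g′ d)
        ; homogeneous = λ b g → ℚ.*-assoc b (g d) (weight L φ)
        ; local       = λ g≗g′ → cong (ℚ._* weight L φ) (g≗g′ (degree≤n (φ x)))
        })
        where d = degree G (φ x)
      merge : ∀ v a b {c} → a ℚ.* b ≡ c →
        a ℚ.* (b ℚ.* weight L (const v)) ≡ c ℚ.* weight L (const v)
      merge v a b ab≡c = trans (sym (ℚ.*-assoc a b (weight L (const v))))
        (cong (ℚ._* weight L (const v)) ab≡c)
      two-steps : ∀ r → Bounded t (stepped s y (stepped r x (weight L)))
      two-steps r with ℕ.≤-total s r
      -- The step at `x` has the higher threshold and survives, so `x` takes over from `y` as the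
      -- distinguished vertex.
      ... | inj₁ s≤r = bounded-mono {t = t}
        (λ φ → drop-step s (degree G (φ y)) (0≤-* (0≤at (step r) (degree G (φ x))) (0≤weight L φ)))
        (λ v → sym (merge v (at (step s) (degree G v)) (at (step r) (degree G v)) (at-step-* (degree G v) s≤r)))
        (concentrate t single-step L x∈P r)
      ... | inj₂ r≤s = bounded-mono {t = t}
        (λ φ → *-monoʳ (0≤at (step s) (degree G (φ y))) (drop-step r (degree G (φ x)) (0≤weight L φ)))
        (λ v → sym (merge v (at (step s) (degree G v)) (at (step r) (degree G v))
          (trans (ℚ.*-comm (at (step s) (degree G v)) (at (step r) (degree G v)))
          (at-step-* (degree G v) r≤s))))
        (concentrate t single-step L y∈P s)

    -- The three bounds are mutually recursive: `tree-bound` reduces to a single step, `step-bound`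
    -- moves the root to that step, and `rooted-bound` removes a leaf and calls `tree-bound` with
    -- one edge fewer.
    tree-bound : ∀ m {w P} (t : Tree H m w P) (L : List (Weight P)) → Bounded t (weight L)
    rooted-bound : ∀ m {w P} (t : Tree H m w P) s → Bounded t (stepped s w (const 1ℚ))
    step-bound : ∀ m {w y P} (t : Tree H m w P) → P y → ∀ s → Bounded t (stepped s y (const 1ℚ))

    -- The step with threshold 0 at the root is identically 1 and supplies the initial distinguished
    -- step.
    tree-bound m t L = bounded-mono {t = t}
      (λ φ → ℚ.≤-reflexive (sym (ℚ.*-identityˡ (weight L φ)))) (λ v → ℚ.*-identityˡ (weight L (const v)))
      (concentrate t (step-bound m t) L (root∈ H t) 0)

    step-bound m {y = y} t y∈P s = subst (ℚ._≤ ℕ→ℚ (n ℕ.^ h) ℚ.* _)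
      (cong (ℕ→ℚ (n ℕ.^ suc m) ℚ.*_) (Sum.sum-cong-≗ {n ℕ.^ h} λ i →
        cong (ℚ._* stepped s y (const 1ℚ) (finToFun i)) (edges-reroot t y∈P (finToFun i))))
      (rooted-bound m (reroot H t y∈P) s)

    -- Equality holds: once `w` is resampled, the summand is the same for all n^h maps.
    rooted-bound zero {w} (single _) s = ℚ.≤-reflexive (begin
      ℕ→ℚ (n ℕ.^ 1) ℚ.* ∑maps K
        ≡⟨ cong (λ k → ℕ→ℚ k ℚ.* ∑maps K) (ℕ.*-identityʳ n) ⟩
      ℕ→ℚ n ℚ.* ∑maps K
        ≡⟨ ∑maps-resample w (λ φ ψ φ≗ψ → cong K′ (φ≗ψ w)) ⟩
      ∑maps (λ φ → sum (λ a → K (updateAt φ w (const a))))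
        ≡⟨ Sum.sum-cong-≗ {n ℕ.^ h} (λ i → Sum.sum-cong-≗ {n} λ a →
             cong K′ (updateAt-updates w {const a} (finToFun i))) ⟩
      ∑maps {h} {n} (λ φ → sum K′)
        ≡⟨ sum-const (n ℕ.^ h) (sum K′) ⟩
      ℕ→ℚ (n ℕ.^ h) ℚ.* sum K′ ∎)
      where
      open ≡-Reasoning
      K′ : Fin n → ℚ
      K′ v = 1ℚ ℚ.* (at (step s) (degree G v) ℚ.* 1ℚ)
      K : (Fin h → Fin n) → ℚ
      K φ = K′ (φ w)
    -- The vertex `u` grown last is a leaf, and it differs from `w` because `w` lies in `P`;
    -- resampling it therefore affects only its own edge.
    rooted-bound (suc m) {w} (grow {x = x} {u} {P} t x∈P x∼u u∉P Q≐) s = begin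
      ℕ→ℚ (n ℕ.* n ℕ.^ suc m) ℚ.* ∑maps K
        ≡⟨ cong (ℚ._* ∑maps K) (ℕ→ℚ-* n (n ℕ.^ suc m)) ⟩
      ℕ→ℚ n ℚ.* ℕ→ℚ (n ℕ.^ suc m) ℚ.* ∑maps K
        ≡⟨ trans (ℚ.*-assoc (ℕ→ℚ n) (ℕ→ℚ (n ℕ.^ suc m)) (∑maps K))
             (x∙yz≈y∙xz (ℕ→ℚ n) (ℕ→ℚ (n ℕ.^ suc m)) (∑maps K)) ⟩
      ℕ→ℚ (n ℕ.^ suc m) ℚ.* (ℕ→ℚ n ℚ.* ∑maps K)
        ≡⟨ cong (ℕ→ℚ (n ℕ.^ suc m) ℚ.*_) (∑maps-resample u extensional) ⟩
      ℕ→ℚ (n ℕ.^ suc m) ℚ.* ∑maps (λ φ → sum (λ a → K (updateAt φ u (const a))))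
        ≡⟨ cong (ℕ→ℚ (n ℕ.^ suc m) ℚ.*_) (Sum.sum-cong-≗ {n ℕ.^ h} λ i → sum-out (finToFun i)) ⟩
      ℕ→ℚ (n ℕ.^ suc m) ℚ.* ∑maps (λ φ → edges t φ ℚ.* weight L φ)
        ≤⟨ tree-bound m t L ⟩
      ℕ→ℚ (n ℕ.^ h) ℚ.* sum (λ v → degℚ v ^ℚ m ℚ.* weight L (const v))
        -- At a constant map the weight `natural` is one more factor `degℚ v`, which raises the
        -- exponent to `suc m`.
        ≡⟨ cong (ℕ→ℚ (n ℕ.^ h) ℚ.*_) (Sum.sum-cong-≗ {n} λ v →
             trans (x∙yz≈y∙xz (degℚ v ^ℚ m) (degℚ v) _) (sym (ℚ.*-assoc (degℚ v) (degℚ v ^ℚ m) _))) ⟩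
      ℕ→ℚ (n ℕ.^ h) ℚ.* sum (λ v → degℚ v ^ℚ suc m ℚ.* stepped s w (const 1ℚ) (const v)) ∎
      where
      open ℚ.≤-Reasoning
      -- Summing the adjacency indicator over the image of the leaf leaves the degree at its
      -- neighbour `x`, which is monotone and becomes a new weight.
      L : List (Weight P)
      L = natural at x ⟨ x∈P ⟩ ∷ step s at w ⟨ root∈ H t ⟩ ∷ []
      J : (Fin h → Fin n) → ℚ
      J φ = edges t φ ℚ.* stepped s w (const 1ℚ) φ
      K : (Fin h → Fin n) → ℚ
      K φ = adj (φ x) (φ u) ℚ.* edges t φ ℚ.* stepped s w (const 1ℚ) φ
      local-J : ∀ {φ ψ} → (∀ {z} → P z → φ z ≡ ψ z) → J φ ≡ J ψ
      local-J φ≗ψ = cong₂ ℚ._*_ (edges-local t φ≗ψ)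
        (cong (λ v → at (step s) (degree G v) ℚ.* 1ℚ) (φ≗ψ (root∈ H t)))
      extensional : Extensional K
      extensional φ ψ φ≗ψ = trans (ℚ.*-assoc (adj (φ x) (φ u)) _ _)
        (trans (cong₂ ℚ._*_ (cong₂ adj (φ≗ψ x) (φ≗ψ u)) (local-J (λ {z} _ → φ≗ψ z)))
          (sym (ℚ.*-assoc (adj (ψ x) (ψ u)) _ _)))
      sum-out : ∀ φ → sum (λ a → K (updateAt φ u (const a))) ≡ edges t φ ℚ.* weight L φ
      sum-out φ = begin-equality
        sum (λ a → K (updateAt φ u (const a)))
          ≡⟨ Sum.sum-cong-≗ {n} (λ a → trans (ℚ.*-assoc (adj _ _) _ _)
               (cong₂ ℚ._*_ (cong₂ adj (update-outside u∉P φ a x∈P) (updateAt-updates u φ))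
                 (local-J (update-outside u∉P φ a)))) ⟩
        sum (λ a → adj (φ x) a ℚ.* J φ)
          ≡⟨ Sum.*-distribʳ-sum {n} (J φ) (adj (φ x)) ⟨
        sum (adj (φ x)) ℚ.* J φ
          ≡⟨ cong (ℚ._* J φ) (sum-adj (φ x)) ⟩
        degℚ (φ x) ℚ.* J φ
          ≡⟨ x∙yz≈y∙xz (degℚ (φ x)) (edges t φ) _ ⟩
        edges t φ ℚ.* weight L φ ∎

-- From spanning trees to homomorphisms, for rational weights

∑ℚ ∏ℚ : ∀ {a} {A : Set a} → List A → (A → ℚ) → ℚ
∑ℚ xs f = foldr (λ x s → f x ℚ.+ s) 0ℚ xs
∏ℚ xs f = foldr (λ x p → f x ℚ.* p) 1ℚ xs

∑ℚ-filter : ∀ {A : Set} {P : A → Set} (P? : ∀ x → Dec (P x)) {J K : A → ℚ} →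
  (∀ {x} → P x → J x ℚ.≤ K x) → (∀ x → 0ℚ ℚ.≤ K x) → ∀ {B : Set} (g : B → A) {n} (f : Fin n → B) →
  ∑ℚ (filter P? (map g (tabulate f))) J ℚ.≤ sum (λ i → K (g (f i)))
∑ℚ-filter P? J≤K 0≤K g {zero}  f = ℚ.≤-refl
∑ℚ-filter P? {J} {K} J≤K 0≤K g {suc n} f with P? (g (f zero))
... | yes p = ℚ.+-mono-≤ (J≤K p) (∑ℚ-filter P? J≤K 0≤K g (f ∘ suc))
... | no  _ = ℚ.≤-trans (ℚ.≤-reflexive (sym (ℚ.+-identityˡ _)))
                (ℚ.+-mono-≤ (0≤K (g (f zero))) (∑ℚ-filter P? J≤K 0≤K g (f ∘ suc)))

-- Every homomorphism of `H` preserves the edges of a spanning tree. Such a tree has h - 1 edges, so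
-- the two powers of `n` in `Bounded` coincide and cancel.
rational-bound : ∀ {h n} (H : Graph h) (G : Graph n) → Connected H → Fin h →
  ∃ λ P → (∀ z → P z) × ∀ (L : List (Weight P)) →
    ∑ℚ (Hom H G) (weight G L) ℚ.≤ sum (λ v → ℕ→ℚ (degree G v) ^ℚ (h ∸ 1) ℚ.* weight G L (const v))
rational-bound {suc m} {n} H G conn o = P , spanning H t ℕ.≤-refl , λ L →
  ℚ.≤-trans (hom≤edges L) (cancel n L G t (tree-bound G H m t L))
  where
  P = proj₁ (tree H conn o m (ℕ.n<1+n m))
  t = proj₂ (tree H conn o m (ℕ.n<1+n m))
  hom≤edges : ∀ L → ∑ℚ (Hom H G) (weight G L) ℚ.≤ ∑maps (λ φ → edges G H t φ ℚ.* weight G L φ)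
  hom≤edges L = ∑ℚ-filter (isHom? H G)
    (λ {φ} φ-hom → ℚ.≤-reflexive (trans (sym (ℚ.*-identityˡ (weight G L φ)))
      (cong (ℚ._* weight G L φ) (sym (edges-hom G H t φ-hom)))))
    (λ φ → 0≤-* (0≤edges G H t φ) (0≤weight G L φ)) finToFun id
  cancel : ∀ n {P} (L : List (Weight P)) (G : Graph n) (t : Tree H m o P) → Bounded G H t (weight G L) →
    ∑maps (λ φ → edges G H t φ ℚ.* weight G L φ)
      ℚ.≤ sum (λ v → ℕ→ℚ (degree G v) ^ℚ m ℚ.* weight G L (const v))
  -- For `n = 0` the power of `n` is 0 and cannot be cancelled, but both sums are empty, since `H`
  -- has a vertex.
  cancel zero    L G t bounded = ℚ.≤-refl
  cancel (suc n) L G t bounded =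
    ℚ.*-cancelˡ-≤-pos (ℕ→ℚ (suc n ℕ.^ suc m)) ⦃ ℚ.positive 0<N ⦄ bounded
    where
    0<N : 0ℚ ℚ.< ℕ→ℚ (suc n ℕ.^ suc m)
    0<N = ℚ.<-≤-trans (ℚ.positive⁻¹ 1ℚ) (ℕ→ℚ-mono (ℕ.m^n>0 (suc n) (suc m)))

-- Elimination and introduction of cuts

0≤? : ∀ p → 0ℚ ℚ.< p ⊎ p ℚ.≤ 0ℚ
0≤? p with 0ℚ ℚ.<? p
... | yes 0<p = inj₁ 0<p
... | no  0≮p = inj₂ (ℚ.≮⇒≥ 0≮p)

+-below : ∀ {q p r} → q ℚ.< p ℚ.+ r → ∃ λ p′ → p′ ℚ.< p × q ℚ.< p′ ℚ.+ r
+-below {q} {p} {r} q<p+r =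
  let p′ , q-r<p′ , p′<p = ℚ.<-dense {q ℚ.- r} {p} (subst (q ℚ.- r ℚ.<_) (cancel p r) (ℚ.+-monoˡ-< (ℚ.- r) q<p+r))
  in p′ , p′<p , subst (ℚ._< p′ ℚ.+ r) (trans (ℚ.+-comm (q ℚ.- r) r) (+-minus r q)) (ℚ.+-monoˡ-< r q-r<p′)
  where
  cancel : ∀ p r → (p ℚ.+ r) ℚ.- r ≡ p
  cancel p r = trans (ℚ.+-assoc p r (ℚ.- r))
    (trans (cong (p ℚ.+_) (ℚ.+-inverseʳ r)) (ℚ.+-identityʳ p))

*-below : ∀ {q p r} → 0ℚ ℚ.≤ p → q ℚ.< p ℚ.* r → ∃ λ r′ → r′ ℚ.< r × q ℚ.< p ℚ.* r′
*-below {q} {p} {r} 0≤p q<p*r with 0≤? p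
-- For `p = 0` both products vanish, so any `r′` below `r` serves. For positive `p`, density is
-- applied between `q` divided by `p` and `r`.
... | inj₂ p≤0 with refl ← ℚ.≤-antisym p≤0 0≤p =
  r ℚ.- 1ℚ , subst (r ℚ.- 1ℚ ℚ.<_) (ℚ.+-identityʳ r) (ℚ.+-monoʳ-< r (ℚ.negative⁻¹ (ℚ.- 1ℚ)))
  , subst (q ℚ.<_) (trans (ℚ.*-zeroˡ r) (sym (ℚ.*-zeroˡ (r ℚ.- 1ℚ)))) q<p*r
... | inj₁ 0<p =
  let r′ , q/p<r′ , r′<r = ℚ.<-dense {p⁻¹ ℚ.* q} {r} (subst (p⁻¹ ℚ.* q ℚ.<_)
        (trans (sym (ℚ.*-assoc p⁻¹ p r)) (trans (cong (ℚ._* r) (ℚ.*-inverseˡ p)) (ℚ.*-identityˡ r)))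
        (ℚ.*-monoʳ-<-pos p⁻¹ ⦃ ℚ.1/pos⇒pos p ⦄ q<p*r))
  in r′ , r′<r , subst (ℚ._< p ℚ.* r′)
       (trans (sym (ℚ.*-assoc p p⁻¹ q)) (trans (cong (ℚ._* q) (ℚ.*-inverseʳ p)) (ℚ.*-identityˡ q)))
       (ℚ.*-monoʳ-<-pos p q/p<r′)
  where
  instance
    p-positive = ℚ.positive 0<p
    p-nonZero = ℚ.pos⇒nonZero p
  p⁻¹ = ℚ.1/ p

-- Says that `x` is at most the supremum of the values of `s`.
Reaches : {A : Set} → (A → ℚ) → ℝ≥0 → Set
Reaches s x = ∀ {q} → q ∈ cut x → ∃ λ a → q ℚ.< s a

-- `p ≼ x` need not put `p` itself in the cut, so the strict inequality is used to lower the two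
-- summands, one after the other, into their cuts.
reaches-+ : ∀ {A B : Set} {x y} {s : A → ℚ} {t : B → ℚ} → Reaches s x → Reaches t y →
  ∀ {q} → q ∈ cut (x + y) → ∃₂ λ a b → q ℚ.< s a ℚ.+ t b
reaches-+ {s = s} {t} s↗x t↗y {q} (_ , q<p+r , p , r , p≼x , r≼y , refl) =
  let p′ , p′<p , q<p′+r = +-below q<p+r
      a , p′<sa = s↗x (p≼x p′<p)
      q<r+sa = subst (q ℚ.<_) (ℚ.+-comm (s a) r) (ℚ.<-trans q<p′+r (ℚ.+-monoˡ-< r p′<sa))
      r′ , r′<r , q<r′+sa = +-below q<r+sa
      b , r′<tb = t↗y (r≼y r′<r)
  in a , b , subst (q ℚ.<_) (ℚ.+-comm (t b) (s a)) (ℚ.<-trans q<r′+sa (ℚ.+-monoˡ-< (s a) r′<tb))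

reaches-* : ∀ {A B : Set} {x y} {s : A → ℚ} {t : B → ℚ} → (∀ a → 0ℚ ℚ.≤ s a) →
  Reaches s x → Reaches t y → ∀ {q} → q ∈ cut (x * y) → ∃₂ λ a b → q ℚ.< s a ℚ.* t b
reaches-* {s = s} {t} 0≤s s↗x t↗y {q} (_ , q<p*r , p , r , 0≤p , 0≤r , p≼x , r≼y , refl) =
  let p′ , p′<p , q<r*p′ = *-below 0≤r (subst (q ℚ.<_) (ℚ.*-comm p r) q<p*r)
      a , p′<sa = s↗x (p≼x p′<p)
      q<sa*r = subst (q ℚ.<_) (ℚ.*-comm r (s a)) (ℚ.<-≤-trans q<r*p′ (*-monoʳ 0≤r (ℚ.<⇒≤ p′<sa)))
      r′ , r′<r , q<sa*r′ = *-below (0≤s a) q<sa*r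
      b , r′<tb = t↗y (r≼y r′<r)
  in a , b , ℚ.<-≤-trans q<sa*r′ (*-monoʳ (0≤s a) (ℚ.<⇒≤ r′<tb))

≼-+ : ∀ {p q} x y → p ≼ x → q ≼ y → p ℚ.+ q ≼ x + y
≼-+ x y p≼x q≼y r<p+q = _ , r<p+q , _ , _ , p≼x , q≼y , refl

≼-* : ∀ {p q} x y → 0ℚ ℚ.≤ p → 0ℚ ℚ.≤ q → p ≼ x → q ≼ y → p ℚ.* q ≼ x * y
≼-* x y 0≤p 0≤q p≼x q≼y r<p*q = _ , r<p*q , _ , _ , 0≤p , 0≤q , p≼x , q≼y , refl

≼-⊔ : ∀ {p q} x → p ≼ x → q ≼ x → p ℚ.⊔ q ≼ x
≼-⊔ {p} {q} x p≼x q≼x {r} r<p⊔q with ℚ.⊔-sel p q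
... | inj₁ p⊔q≡p = p≼x (subst (r ℚ.<_) p⊔q≡p r<p⊔q)
... | inj₂ p⊔q≡q = q≼x (subst (r ℚ.<_) p⊔q≡q r<p⊔q)

≼-sum : ∀ {A : Set} {n} (x : A → ℝ≥0) (g : Fin n → A) {f : Fin n → ℚ} →
  (∀ i → f i ≼ x (g i)) → sum f ≼ ∑ (tabulate g) x
≼-sum {n = zero}  x g f≼x = 0≼ (fromℕ 0)
≼-sum {n = suc n} x g f≼x = ≼-+ (x (g zero)) (∑ (tabulate (g ∘ suc)) x) (f≼x zero) (≼-sum x (g ∘ suc) (f≼x ∘ suc))

-- Powers

fromℕ-mono : ∀ {k l} → k ℕ.≤ l → fromℕ k ≤ fromℕ l
fromℕ-mono k≤l (_ , q<r , inj₁ refl) = 0ℚ , q<r , inj₁ refl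
fromℕ-mono {k} {l} k≤l (_ , q<r , inj₂ refl) = ℕ→ℚ l , ℚ.<-≤-trans q<r (ℕ→ℚ-mono k≤l) , inj₂ refl

𝟙-mono : ∀ {P Q : Set} → (P → Q) → 𝟙 P ≤ 𝟙 Q
𝟙-mono P→Q (r , q<r , inj₁ r≡0)       = r , q<r , inj₁ r≡0
𝟙-mono P→Q (r , q<r , inj₂ (r≡1 , p)) = r , q<r , inj₂ (r≡1 , P→Q p)

^-monoˡ : ∀ {p q} n → 0ℚ ℚ.≤ p → p ℚ.≤ q → p ^ℚ n ℚ.≤ q ^ℚ n
^-monoˡ zero    0≤p p≤q = ℚ.≤-refl
^-monoˡ (suc n) 0≤p p≤q = *-mono (0≤^ n 0≤p) (ℚ.≤-trans 0≤p p≤q) p≤q (^-monoˡ n 0≤p p≤q)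

^-mono-base : ∀ {d e} α → d ℕ.≤ e → d ^ α ≤ e ^ α
^-mono-base {zero}  {zero}  α d≤e q∈ = q∈
^-mono-base {zero}  {suc e} α d≤e (_ , q<0 , inj₁ refl) = negative (suc e ^ α) q<0
-- Here 0 ^ α is 1; the larger power is at least 1 because the exponent 0 / 1 is at most α.
^-mono-base {zero}  {suc e} α d≤e (_ , q<1 , inj₂ (refl , _)) =
  1ℚ , q<1 , 0≤1 , 0 , 0 , 0≼ α , ℚ.≤-refl
^-mono-base {suc d} {suc e} α d≤e (r , q<r , 0≤r , m , n , m/n≼α , r^n≤d^m) =
  r , q<r , 0≤r , m , n , m/n≼α , ℚ.≤-trans r^n≤d^m (^-monoˡ m (0≤ℕ→ℚ (suc d)) (ℕ→ℚ-mono d≤e))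

+-zero : ∀ x y → x ≤ fromℕ 0 → y ≤ fromℕ 0 → x + y ≤ fromℕ 0
+-zero x y x≤0 y≤0 (_ , q<p+r , p , r , p≼x , r≼y , refl) = negative (fromℕ 0)
  (ℚ.<-≤-trans q<p+r (ℚ.+-mono-≤ (bound x x≤0 p≼x) (bound y y≤0 r≼y)))
  where
  bound : ∀ {p} x → x ≤ fromℕ 0 → p ≼ x → p ℚ.≤ 0ℚ
  bound x x≤0 = ≼-bound x λ q∈x → ℚ.<⇒≤ (below (x≤0 q∈x))
    where
    below : ∀ {q} → q ∈ cut (fromℕ 0) → q ℚ.< 0ℚ
    below (_ , q<0 , inj₁ refl) = q<0
    below (_ , q<0 , inj₂ refl) = q<0

-- For positive `d`, rational exponents below `x` and `y` are brought to a common denominator. For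
-- `d = 0` a nonzero product forces both exponents, hence their sum, to be 0.
^-homo-* : ∀ d x y → d ^ x * d ^ y ≤ d ^ (x + y)
^-homo-* zero x y {q} q∈ with reaches-* {x = 0 ^ x} {0 ^ y} {proj₁} {proj₁} 0≤elem
                               (λ (r , q<r , r∈) → (r , r∈) , q<r) (λ (r , q<r , r∈) → (r , r∈) , q<r) q∈
  where
  0≤elem : ∀ {P} (a : ∃ λ r → r ≡ 0ℚ ⊎ (r ≡ 1ℚ × P)) → 0ℚ ℚ.≤ proj₁ a
  0≤elem (_ , inj₁ refl)       = ℚ.≤-refl
  0≤elem (_ , inj₂ (refl , _)) = 0≤1
... | (_ , inj₁ refl) , (t , _) , q<0*t = negative (0 ^ (x + y)) (subst (q ℚ.<_) (ℚ.*-zeroˡ t) q<0*t)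
... | (s , inj₂ _) , (_ , inj₁ refl) , q<s*0 = negative (0 ^ (x + y)) (subst (q ℚ.<_) (ℚ.*-zeroʳ s) q<s*0)
... | (_ , inj₂ (refl , x≤0)) , (_ , inj₂ (refl , y≤0)) , q<1 =
  1ℚ , q<1 , inj₂ (refl , λ {q} → +-zero x y x≤0 y≤0 {q})
^-homo-* (suc d) x y q∈ with reaches-* {x = suc d ^ x} {suc d ^ y} {proj₁} {proj₁} (λ (r , 0≤r , _) → 0≤r)
                              (λ (r , q<r , r∈) → (r , r∈) , q<r) (λ (r , q<r , r∈) → (r , r∈) , q<r) q∈
... | (s , 0≤s , m , n , m/n≼x , s^n≤D^m) , (t , 0≤t , m′ , n′ , m′/n′≼y , t^n′≤D^m′) , q<s*t =
  -- Denominators are stored as predecessors: the last component is one less than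
  -- `suc n ℕ.* suc n′`.
  s ℚ.* t , q<s*t , 0≤-* 0≤s 0≤t , m ℕ.* suc n′ ℕ.+ m′ ℕ.* suc n , n′ ℕ.+ n ℕ.* suc n′
  , subst (_≼ x + y) (/-+ m n m′ n′) (≼-+ x y m/n≼x m′/n′≼y)
  , (begin
    (s ℚ.* t) ^ℚ (suc n ℕ.* suc n′)
      ≡⟨ Exp.^-distrib-* s t (suc n ℕ.* suc n′) ⟩
    s ^ℚ (suc n ℕ.* suc n′) ℚ.* t ^ℚ (suc n ℕ.* suc n′)
      ≡⟨ cong₂ ℚ._*_ (sym (Exp.^-assocʳ s (suc n) (suc n′)))
           (trans (cong (t ^ℚ_) (ℕ.*-comm (suc n) (suc n′))) (sym (Exp.^-assocʳ t (suc n′) (suc n)))) ⟩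
    (s ^ℚ suc n) ^ℚ suc n′ ℚ.* (t ^ℚ suc n′) ^ℚ suc n
      ≤⟨ *-mono (0≤^ (suc n) (0≤^ (suc n′) 0≤t)) (0≤^ (suc n′) (0≤^ m (0≤ℕ→ℚ (suc d))))
           (^-monoˡ (suc n′) (0≤^ (suc n) 0≤s) s^n≤D^m) (^-monoˡ (suc n) (0≤^ (suc n′) 0≤t) t^n′≤D^m′) ⟩
    (D ^ℚ m) ^ℚ suc n′ ℚ.* (D ^ℚ m′) ^ℚ suc n
      ≡⟨ cong₂ ℚ._*_ (Exp.^-assocʳ D m (suc n′)) (Exp.^-assocʳ D m′ (suc n)) ⟩
    D ^ℚ (m ℕ.* suc n′) ℚ.* D ^ℚ (m′ ℕ.* suc n)
      ≡⟨ Exp.^-homo-* D (m ℕ.* suc n′) (m′ ℕ.* suc n) ⟨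
    D ^ℚ (m ℕ.* suc n′ ℕ.+ m′ ℕ.* suc n) ∎)
  where
  open ℚ.≤-Reasoning
  D : ℚ
  D = ℕ→ℚ (suc d)

≼-fromℕ : ∀ m → ℕ→ℚ m ≼ fromℕ m
≼-fromℕ m q<m = ℕ→ℚ m , q<m , inj₂ refl

≼-^-fromℕ : ∀ d m → ℕ→ℚ d ^ℚ m ≼ d ^ fromℕ m
≼-^-fromℕ zero    zero    q<1 = 1ℚ , q<1 , inj₂ (refl , id)
≼-^-fromℕ zero    (suc m) {q} q<0 =
  negative (0 ^ fromℕ (suc m)) (subst (q ℚ.<_) (ℚ.*-zeroˡ (ℕ→ℚ 0 ^ℚ m)) q<0)
≼-^-fromℕ (suc d) m       q<D^m =
  D ^ℚ m , q<D^m , 0≤^ m (0≤ℕ→ℚ (suc d)) , m , 0 , ≼-fromℕ m , ℚ.≤-reflexive (ℚ.*-identityʳ (D ^ℚ m))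
  where
  D : ℚ
  D = ℕ→ℚ (suc d)

≼-^-+ : ∀ {p q} d x y → 0ℚ ℚ.≤ p → 0ℚ ℚ.≤ q → p ≼ d ^ x → q ≼ d ^ y → p ℚ.* q ≼ d ^ (x + y)
≼-^-+ d x y 0≤p 0≤q p≼ q≼ r< = ^-homo-* d x y (≼-* (d ^ x) (d ^ y) 0≤p 0≤q p≼ q≼ r<)

0≤∏ℚ : ∀ {A : Set} (xs : List A) {f : A → ℚ} → (∀ a → 0ℚ ℚ.≤ f a) → 0ℚ ℚ.≤ ∏ℚ xs f
0≤∏ℚ []       0≤f = 0≤1
0≤∏ℚ (a ∷ xs) 0≤f = 0≤-* (0≤f a) (0≤∏ℚ xs 0≤f)

≼-^-∑ : ∀ {A : Set} d (xs : List A) (α : A → ℝ≥0) {f : A → ℚ} → (∀ a → 0ℚ ℚ.≤ f a) →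
  (∀ a → f a ≼ d ^ α a) → ∏ℚ xs f ≼ d ^ ∑ xs α
≼-^-∑ d []       α 0≤f f≼ = ≼-^-fromℕ d 0
≼-^-∑ d (a ∷ xs) α 0≤f f≼ = ≼-^-+ d (α a) (∑ xs α) (0≤f a) (0≤∏ℚ xs 0≤f) (f≼ a) (≼-^-∑ d xs α 0≤f f≼)

-- Approximation from below by monotone rational functions

-- Cuts admit no subtraction, so the layer cake decomposition is only available
-- for rational minorants, which must be chosen jointly and monotone.
module Approximation {I : Set} (_≟_ : ∀ (i j : I) → Dec (i ≡ j)) (F : I → ℕ → ℝ≥0)
  (F-mono : ∀ i {k l} → k ℕ.≤ l → F i k ≤ F i l) where

  record Family : Set where
    field
      fun   : I → Monotone
      below : ∀ i k → at (fun i) k ≼ F i k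

  open Family public

  _⊑_ : Family → Family → Set
  g ⊑ g′ = ∀ i k → at (fun g i) k ℚ.≤ at (fun g′ i) k

  -- Pointwise maxima make the families directed, so that finitely many demands, over all
  -- homomorphisms and all factors, are met by one family.
  _⊔_ : Family → Family → Family
  g ⊔ g′ = record
    { fun   = λ i → record
      { at   = λ k → at (fun g i) k ℚ.⊔ at (fun g′ i) k
      ; 0≤at = λ k → ℚ.≤-trans (0≤at (fun g i) k) (ℚ.p≤p⊔q (at (fun g i) k) (at (fun g′ i) k))
      ; mono = λ k≤l → ℚ.⊔-mono-≤ (mono (fun g i) k≤l) (mono (fun g′ i) k≤l)
      }
    ; below = λ i k → ≼-⊔ (F i k) (below g i k) (below g′ i k)
    }

  ⊑-⊔ˡ : ∀ g g′ → g ⊑ (g ⊔ g′)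
  ⊑-⊔ˡ g g′ i k = ℚ.p≤p⊔q (at (fun g i) k) (at (fun g′ i) k)

  ⊑-⊔ʳ : ∀ g g′ → g′ ⊑ (g ⊔ g′)
  ⊑-⊔ʳ g g′ i k = ℚ.p≤q⊔p (at (fun g i) k) (at (fun g′ i) k)

  -- A step of height `p` from `k` onwards in the coordinate `i`, and zero in all others. It stays
  -- below `F i` because `F i` is monotone.
  bump : ∀ i k {p} → 0ℚ ℚ.≤ p → p ≼ F i k → Family
  bump i k {p} 0≤p p≼ = record
    { fun   = λ j → record
      { at   = λ l → 𝕀 (here? j l) ℚ.* p
      ; 0≤at = λ l → 0≤-* (0≤𝕀 (here? j l)) 0≤p
      ; mono = λ {l} {l′} l≤l′ → ℚ.*-monoʳ-≤-nonNeg p ⦃ ℚ.nonNegative 0≤p ⦄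
          (𝕀-mono (here? j l) (here? j l′) λ (i≡j , k≤l) → i≡j , ℕ.≤-trans k≤l l≤l′)
      }
    ; below = below′
    }
    where
    here? : ∀ j l → Dec (i ≡ j × k ℕ.≤ l)
    here? j l = (i ≟ j) ×-dec (k ℕ.≤? l)
    below′ : ∀ j l → 𝕀 (here? j l) ℚ.* p ≼ F j l
    below′ j l {q} q< with here? j l | q<
    ... | yes (refl , k≤l) | q<p = F-mono i k≤l (p≼ (subst (q ℚ.<_) (ℚ.*-identityˡ p) q<p))
    ... | no  _            | q<0 = negative (F j l) (subst (q ℚ.<_) (ℚ.*-zeroˡ p) q<0)

  bump-at : ∀ i k {p} (0≤p : 0ℚ ℚ.≤ p) (p≼ : p ≼ F i k) → at (fun (bump i k 0≤p p≼) i) k ≡ p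
  bump-at i k {p} 0≤p p≼ =
    trans (cong (ℚ._* p) (𝕀-true ((i ≟ i) ×-dec (k ℕ.≤? k)) (refl , ℕ.≤-refl))) (ℚ.*-identityˡ p)

  null : Family
  null = record
    { fun   = λ i → record { at = λ k → 0ℚ ; 0≤at = λ k → ℚ.≤-refl ; mono = λ _ → ℚ.≤-refl }
    ; below = λ i k → 0≼ (F i k)
    }

  -- `monotonic` preserves what has been reached when two families are joined; `0≤value` is what
  -- products require.
  record Approximates (e : Family → ℚ) (x : ℝ≥0) : Set where
    field
      reach     : Reaches e x
      0≤value   : ∀ g → 0ℚ ℚ.≤ e g
      monotonic : ∀ {g g′} → g ⊑ g′ → e g ℚ.≤ e g′

  open Approximates public

  approx-at : ∀ i k → Approximates (λ g → at (fun g i) k) (F i k)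
  approx-at i k = record
    { reach     = λ {q} q∈ →
        let r , q<r , r∈ = open′ (F i k) q∈
            -- Values of a family are non-negative, whereas `r` may be negative; hence the maximum
            -- with 0.
            g = bump i k (ℚ.p≤q⊔p r 0ℚ) (r⊔0≼ r∈)
        in g , ℚ.<-≤-trans q<r (ℚ.≤-trans (ℚ.p≤p⊔q r 0ℚ)
             (ℚ.≤-reflexive (sym (bump-at i k (ℚ.p≤q⊔p r 0ℚ) (r⊔0≼ r∈)))))
    ; 0≤value   = λ g → 0≤at (fun g i) k
    ; monotonic = λ g⊑g′ → g⊑g′ i k
    }
    where
    r⊔0≼ : ∀ {r} → r ∈ cut (F i k) → r ℚ.⊔ 0ℚ ≼ F i k
    r⊔0≼ r∈ = ≼-⊔ (F i k) (λ q<r → closed (F i k) q<r r∈) (0≼ (F i k))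

  approx-fromℕ : ∀ n → Approximates (const (ℕ→ℚ n)) (fromℕ n)
  approx-fromℕ n = record
    { reach     = λ { (_ , q<r , inj₁ refl) → null , ℚ.<-≤-trans q<r (0≤ℕ→ℚ n)
                    ; (_ , q<r , inj₂ refl) → null , q<r }
    ; 0≤value   = λ _ → 0≤ℕ→ℚ n
    ; monotonic = λ _ → ℚ.≤-refl
    }

  approx-+ : ∀ {e e′ x y} → Approximates e x → Approximates e′ y →
    Approximates (λ g → e g ℚ.+ e′ g) (x + y)
  approx-+ {e} {e′} {x} {y} a b = record
    { reach     = λ {q} q∈ →
        let g , g′ , q< = reaches-+ {x = x} {y} {e} {e′} (reach a) (reach b) q∈
        in (g ⊔ g′) , ℚ.<-≤-trans q< (ℚ.+-mono-≤ (monotonic a (⊑-⊔ˡ g g′)) (monotonic b (⊑-⊔ʳ g g′)))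
    ; 0≤value   = λ g → ℚ.≤-trans (ℚ.≤-reflexive (sym (ℚ.+-identityˡ 0ℚ))) (ℚ.+-mono-≤ (0≤value a g) (0≤value b g))
    ; monotonic = λ g⊑g′ → ℚ.+-mono-≤ (monotonic a g⊑g′) (monotonic b g⊑g′)
    }

  approx-* : ∀ {e e′ x y} → Approximates e x → Approximates e′ y →
    Approximates (λ g → e g ℚ.* e′ g) (x * y)
  approx-* {e} {e′} {x} {y} a b = record
    { reach     = λ {q} q∈ →
        let g , g′ , q< = reaches-* {x = x} {y} {e} {e′} (0≤value a) (reach a) (reach b) q∈
        in (g ⊔ g′) , ℚ.<-≤-trans q< (*-mono (0≤value b g′) (0≤value a (g ⊔ g′))
             (monotonic a (⊑-⊔ˡ g g′)) (monotonic b (⊑-⊔ʳ g g′)))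
    ; 0≤value   = λ g → 0≤-* (0≤value a g) (0≤value b g)
    ; monotonic = λ {g} {g′} g⊑g′ → *-mono (0≤value b g) (0≤value a g′) (monotonic a g⊑g′) (monotonic b g⊑g′)
    }

  approx-∑ : ∀ {A : Set} (xs : List A) {e : A → Family → ℚ} {x : A → ℝ≥0} →
    (∀ a → Approximates (e a) (x a)) → Approximates (λ g → ∑ℚ xs (λ a → e a g)) (∑ xs x)
  approx-∑ []       approx = approx-fromℕ 0
  approx-∑ (a ∷ xs) approx = approx-+ (approx a) (approx-∑ xs approx)

  approx-∏ : ∀ {A : Set} (xs : List A) {e : A → Family → ℚ} {x : A → ℝ≥0} →
    (∀ a → Approximates (e a) (x a)) → Approximates (λ g → ∏ℚ xs (λ a → e a g)) (∏ xs x)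
  approx-∏ []       approx = approx-fromℕ 1
  approx-∏ (a ∷ xs) approx = approx-* (approx a) (approx-∏ xs approx)

-- The bound for real exponents

∑ℚ-cong : ∀ {A : Set} (xs : List A) {f g : A → ℚ} → (∀ a → f a ≡ g a) → ∑ℚ xs f ≡ ∑ℚ xs g
∑ℚ-cong []       f≗g = refl
∑ℚ-cong (a ∷ xs) f≗g = cong₂ ℚ._+_ (f≗g a) (∑ℚ-cong xs f≗g)

weight-map : ∀ {h n} (G : Graph n) {P : Pred (Fin h) 0ℓ} (all∈ : ∀ w → P w) (f : Fin h → Monotone) ws φ →
  weight G (map (λ w → f w at w ⟨ all∈ w ⟩) ws) φ ≡ ∏ℚ ws (λ w → at (f w) (degree G (φ w)))
weight-map G all∈ f []       φ = refl
weight-map G all∈ f (w ∷ ws) φ = cong (at (f w) (degree G (φ w)) ℚ.*_) (weight-map G all∈ f ws φ)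

theorem3 : ∀ {h n : ℕ} (H : Graph h) → Connected H → (o : Fin h) →
    (G : Graph n) (Δ : ℝ≥0) (α : Fin h → ℝ≥0) →
    hom Δ α H o G
    ≤ ∑ (allFin n) (λ v →
    degree G v ^ (fromℕ (h ∸ 1) + ∑ (allFin h) α)
    * 𝟙 (Δ ≤ fromℕ (degree G v)))
theorem3 {h} {n} H conn o G Δ α {q} q∈ =
  -- A rational `q` below the left side is already below the count for some rational family `g`; the
  -- rational bound applies to `g`, and its vertex terms lie below the real ones.
  let g , q<hom = reach approximation q∈
  in ≼-sum _ id (vertex-bound g) (ℚ.<-≤-trans q<hom (hom-bound g))
  where
  -- The indicator is treated as one more monotone factor, with the index `nothing` and sitting at
  -- `o`.
  factor : Maybe (Fin h) → ℕ → ℝ≥0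
  factor nothing  k = 𝟙 (Δ ≤ fromℕ k)
  factor (just w) k = k ^ α w

  factor-mono : ∀ i {k l} → k ℕ.≤ l → factor i k ≤ factor i l
  factor-mono nothing {k} {l} k≤l = 𝟙-mono {Δ ≤ fromℕ k} {Δ ≤ fromℕ l}
    λ Δ≤k {q} q∈Δ → fromℕ-mono k≤l {q} (Δ≤k q∈Δ)
  factor-mono (just w) k≤l = ^-mono-base (α w) k≤l

  open Approximation (≡-dec Fin._≟_) factor factor-mono

  value : Family → Maybe (Fin h) → ℕ → ℚ
  value g i = at (fun g i)

  term : (Fin h → Fin n) → Family → ℚ
  term φ g = value g nothing (degree G (φ o)) ℚ.* ∏ℚ (allFin h) (λ w → value g (just w) (degree G (φ w)))

  approximation : Approximates (λ g → ∑ℚ (Hom H G) (λ φ → term φ g)) (hom Δ α H o G)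
  approximation = approx-∑ (Hom H G) λ φ → approx-* (approx-at nothing (degree G (φ o)))
    (approx-∏ (allFin h) λ w → approx-at (just w) (degree G (φ w)))

  hom-bound : ∀ g → ∑ℚ (Hom H G) (λ φ → term φ g)
    ℚ.≤ sum (λ v → ℕ→ℚ (degree G v) ^ℚ (h ∸ 1) ℚ.* term (const v) g)
  hom-bound g =
    let P , all∈ , bound = rational-bound H G conn o
        L = fun g nothing at o ⟨ all∈ o ⟩ ∷ map (λ w → fun g (just w) at w ⟨ all∈ w ⟩) (allFin h)
        L≡term = λ φ → cong (value g nothing (degree G (φ o)) ℚ.*_)
                         (weight-map G all∈ (λ w → fun g (just w)) (allFin h) φ)
    in subst₂ ℚ._≤_ (∑ℚ-cong (Hom H G) L≡term)
         (Sum.sum-cong-≗ {n} λ v → cong (ℕ→ℚ (degree G v) ^ℚ (h ∸ 1) ℚ.*_) (L≡term (const v)))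
         (bound L)

  -- At a constant map all factors are powers of the same degree, so the exponents h - 1 and α add
  -- up; the indicator is moved to the right.
  vertex-bound : ∀ g v → ℕ→ℚ (degree G v) ^ℚ (h ∸ 1) ℚ.* term (const v) g
    ≼ degree G v ^ (fromℕ (h ∸ 1) + ∑ (allFin h) α) * 𝟙 (Δ ≤ fromℕ (degree G v))
  vertex-bound g v = subst (_≼ d ^ (fromℕ (h ∸ 1) + ∑ (allFin h) α) * 𝟙 (Δ ≤ fromℕ d))
    (sym (x∙yz≈xz∙y D^ (value g nothing d) ∏g))
    (≼-* (d ^ (fromℕ (h ∸ 1) + ∑ (allFin h) α)) (𝟙 (Δ ≤ fromℕ d))
      (0≤-* 0≤D^ 0≤∏g) (0≤at (fun g nothing) d)
      (≼-^-+ d (fromℕ (h ∸ 1)) (∑ (allFin h) α) 0≤D^ 0≤∏g (≼-^-fromℕ d (h ∸ 1))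
        (≼-^-∑ d (allFin h) α (λ w → 0≤at (fun g (just w)) d) (λ w → below g (just w) d)))
      (below g nothing d))
    where
    d = degree G v
    D^ = ℕ→ℚ d ^ℚ (h ∸ 1)
    ∏g = ∏ℚ (allFin h) (λ w → value g (just w) d)
    0≤D^ = 0≤^ (h ∸ 1) (0≤ℕ→ℚ d)
    0≤∏g = 0≤∏ℚ (allFin h) (λ w → 0≤at (fun g (just w)) d)
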